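{- Let $\Psi:\mathcal{T}\to\mathrm{Sym}$ be the unital algebra homomorphism determined by $\Psi(X_\pi)=\prod_{W\in\mathrm{Kr}(\pi)}Y_{|W|}$ for all $\pi\in\sqcup_{n=1}^\infty NC(n)$, and consider the groups of characters $\mathbb{X}(\mathrm{Sym})$ and $\mathbb{X}(\mathcal{T})$ of the Hopf algebras $\mathrm{Sym}$ and $\mathcal{T}$. (1) One has an injective group homomorphism $\Psi^*:\mathbb{X}(\mathrm{Sym})\to\mathbb{X}(\mathcal{T})$ defined by $\Psi^*(\chi):=\chi\circ\Psi$, $\chi\in\mathbb{X}(\mathrm{Sym})$. (2) Under the identifications $\mathbb{X}(\mathrm{Sym})=\{\widehat{\chi}_f\mid f\in\mathcal{G}\}$ and $\mathbb{X}(\mathcal{T})=\{\chi_g\mid g\in\widetilde{\mathcal{G}}\}$, the homomorphism $\Psi^*$ is the inclusion of $\mathcal{G}$ into $\widetilde{\mathcal{G}}$; that is, $\Psi^*(\widehat{\chi}_f)=\chi_f$ for all $f\in\mathcal{G}$.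
   Context: For $n \ge 1$, $NC(n)$ is the set of non-crossing partitions of $\{1,\ldots,n\}$, partially ordered by reverse refinement: $\pi \le \sigma$ iff every block of $\sigma$ is a union of blocks of $\pi$. $1_n \in NC(n)$ is the partition with a single block, $0_n$ the partition with $n$ singleton blocks. Put $NC^{(2)} := \sqcup_{n=1}^{\infty} \{ (\pi,\sigma) \mid \pi,\sigma \in NC(n),\ \pi \le \sigma \}$. For $\pi \in NC(n)$ and a non-empty $W = \{p_1 < \cdots < p_m\} \subseteq \{1,\ldots,n\}$, $\pi_W \in NC(m)$ is the partition for which $i,j$ are in the same block of $\pi_W$ iff $p_i,p_j$ are in the same block of $\pi$. Kreweras complement: for $\pi \in NC(n)$, $\mathrm{Kr}(\pi) \in NC(n)$ is the largest $\sigma \in NC(n)$ such that, placing $\pi$ on the points $1,\ldots,n$ and $\sigma$ on the points $1',\ldots,n'$, the union of $\pi$ and $\sigma$ is a non-crossing partition of the ordered set $1<1'<2<2'<\cdots<n<n'$. $\widetilde{\mathcal{G}}$ is the set of functions $g : NC^{(2)} \to \mathbb{C}$ such that $g(\pi,\pi)=1$ for all $\pi$ and $g(\pi,\sigma) = \prod_{W \in \sigma} g(\pi_W, 1_{|W|})$ for every $n \ge 1$ and $\pi \le \sigma$ in $NC(n)$. It is a group under convolution, $(f*g)(\pi,\sigma) = \sum_{\rho:\ \pi \le \rho \le \sigma} f(\pi,\rho) g(\rho,\sigma)$. $\mathcal{G}$ is the subgroup of multiplicative functions: those $g \in \widetilde{\mathcal{G}}$ with $g(\pi,1_n) = g(0_n,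 \mathrm{Kr}(\pi))$ for all $n \ge 1$, $\pi \in NC(n)$. $\mathcal{T}=\mathbb{C}\bigl[X_\pi\mid\pi\in\sqcup_{n=1}^\infty(NC(n)\setminus\{1_n\})\bigr]$ is the commutative polynomial algebra, with the convention $X_{1_n}:=1_{\mathcal{T}}$. It is a Hopf algebra with comultiplication the unital algebra homomorphism determined by $\Delta(X_\pi)=\sum_{\sigma\in NC(n),\ \sigma\ge\pi}\bigl(\prod_{W\in\sigma}X_{\pi_W}\bigr)\otimes X_\sigma$ and counit the unital algebra homomorphism determined by $\epsilon(X_\pi)=0$ for $\pi\in\sqcup_n(NC(n)\setminus\{1_n\})$. $\mathrm{Sym}$ is the Hopf algebra of symmetric functions, in its incarnation as the commutative polynomial algebra $\mathbb{C}[Y_2,Y_3,\ldots]$ (the $Y_n$ being the parking-function symmetric functions), with the convention $Y_1:=1_{\mathrm{Sym}}$. Its comultiplication is the unital algebra homomorphism with $\Delta(Y_n)=\sum_{\pi\in NC(n)}\bigl(\prod_{V\in\pi}Y_{|V|}\bigr)\otimes\bigl(\prod_{W\in\mathrm{Kr}(\pi)}Y_{|W|}\bigr)$ for $n\ge1$, and its counit is the unital algebra homomorphism with $\varepsilon(Y_n)=0$ for $n\ge2$. For a Hopf algebra $H$ among these, $\mathbb{X}(H)$ is the set of characters (unital algebra homomorphisms $H\to\mathbb{C}$), a group under $\chi_1*\chi_2=(\chi_1\otimes\chi_2)\circ\Delta$. For $g\in\widetilde{\mathcal{G}}$, $\chi_g\in\mathbb{X}(\mathcal{T})$ is the character with $\chi_g(X_\pi)=g(\pi,1_n)$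 for all $n\ge1$, $\pi\in NC(n)$; the map $g\mapsto\chi_g$ is a group isomorphism $\widetilde{\mathcal{G}}\to\mathbb{X}(\mathcal{T})$. For $f\in\mathcal{G}$, $\widehat{\chi}_f\in\mathbb{X}(\mathrm{Sym})$ is the character with $\widehat{\chi}_f(Y_n)=f(0_n,1_n)$ for all $n\ge1$; the map $f\mapsto\widehat{\chi}_f$ is a group isomorphism $\mathcal{G}\to\mathbb{X}(\mathrm{Sym})$. -}

module Defs where

open import Algebra.Bundles using (CommutativeRing; RawMonoid)
open import Algebra.Morphism.Structures using (module RingMorphisms)
import Algebra.Morphism.Construct.Composition as Composition
import Algebra.Morphism.Construct.Identity as Identity
open import Data.Bool.Base using (Bool; true; false; not; _∧_; _xor_)
import Data.Bool.Properties as Bool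
open import Data.Empty using (⊥; ⊥-elim)
open import Data.Fin.Base using (Fin; zero; suc; toℕ; _<_; _≤_)
import Data.Fin.Properties as Fin
open import Data.Fin.Subset using (Subset; inside; outside; _∈_; _⊆_; ∣_∣; Nonempty; ⁅_⁆)
open import Data.Fin.Subset.Properties
  using (_∈?_; _⊆?_; nonempty?; x∈⁅x⁆; x∈⁅y⁆⇒x≡y; ∣⁅x⁆∣≡1; ⊆-antisym)
open import Data.List.Base as List
  using (List; []; _∷_; [_]; foldr; map; filter; mapMaybe; deduplicate; cartesianProductWith)
open import Data.List.Relation.Unary.All using (All; []; _∷_)
import Data.List.Relation.Unary.All.Properties as All
open import Data.Maybe.Base as Maybe using (Maybe)
open import Data.Nat.Base as ℕ using (ℕ; zero; suc; NonZero)
import Data.Nat.Properties as ℕ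
open import Data.Product.Base using (Σ; Σ-syntax; _×_; _,_; proj₁; proj₂)
open import Data.Sum.Base using (_⊎_; inj₁; inj₂)
open import Data.Sum.Relation.Binary.Pointwise using (Pointwise; inj₁; inj₂)
open import Data.Unit.Base using (⊤; tt)
open import Data.Vec.Base as Vec using (Vec; []; _∷_; lookup; tabulate; here; there)
import Data.Vec.Properties as Vec
open import Function.Base using (_∘_)
open import Level using (Level; _⊔_) renaming (suc to lsuc)
open import Relation.Binary.Core using (Rel)
open import Relation.Binary.Definitions using (Decidable; DecidableEquality; tri<; tri≈; tri>)
open import Relation.Binary.Structures using (IsEquivalence)
open import Relation.Binary.PropositionalEquality
  using (_≡_; _≢_; refl; sym; trans; cong; cong₂; subst; module ≡-Reasoning)
  renaming (isEquivalence to ≡-isEquivalence)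
open import Relation.Nullary.Decidable
  using (Dec; yes; no; does; map′; _×-dec_; _→-dec_; recompute; dec⇒maybe; dec-true; dec-false)
open import Relation.Nullary.Negation using (¬_; contradiction)

NonCrossing : ∀ {a r s} {A : Set a} → Rel A r → Rel A s → Set (a ⊔ r ⊔ s)
NonCrossing _≺_ _~_ =
  ∀ {a b c d} → a ≺ b → b ≺ c → c ≺ d → a ~ c → b ~ d → a ~ b

-- A partition of Fin n is stored as the vector whose i-th entry is the
-- block of i.

SameBlock : ∀ {n} → Vec (Subset n) n → Rel (Fin n) _
SameBlock M i j = j ∈ lookup M i

record IsNC {n} (M : Vec (Subset n) n) : Set where
  field
    nonZero       : NonZero n
    isEquivalence : IsEquivalence (SameBlock M)
    nonCrossing   : NonCrossing _<_ (SameBlock M)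

-- The proof field is irrelevant, so that two non-crossing partitions
-- are equal as soon as they have the same blocks.

record NC (n : ℕ) : Set where
  constructor mkNC
  field
    blockVec : Vec (Subset n) n
    .isNC    : IsNC blockVec

  blockOf : Fin n → Subset n
  blockOf = lookup blockVec

open NC public using (blockVec; blockOf)

isNC? : ∀ {n} (M : Vec (Subset n) n) → Dec (IsNC M)
isNC? {n} M =
  map′ (λ (z , r , s , t , x) → record
          { nonZero       = z
          ; isEquivalence = record
              { refl  = λ {i} → r i
              ; sym   = λ {i j} → s i j
              ; trans = λ {i j k} → t i j k }
          ; nonCrossing   = λ {a b c d} → x a b c d })
       (λ p → IsNC.nonZero p
            , (λ i → IsEquivalence.refl (IsNC.isEquivalence p))
            , (λ i j → IsEquivalence.sym (IsNC.isEquivalence p))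
            , (λ i j k → IsEquivalence.trans (IsNC.isEquivalence p))
            , (λ a b c d → IsNC.nonCrossing p))
       (ℕ.nonZero? n ×-dec
        Fin.all? (λ i → i ~? i) ×-dec
        Fin.all? (λ i → Fin.all? λ j → i ~? j →-dec j ~? i) ×-dec
        Fin.all? (λ i → Fin.all? λ j → Fin.all? λ k →
          i ~? j →-dec j ~? k →-dec i ~? k) ×-dec
        Fin.all? (λ a → Fin.all? λ b → Fin.all? λ c → Fin.all? λ d →
          a Fin.<? b →-dec b Fin.<? c →-dec c Fin.<? d →-dec
          a ~? c →-dec b ~? d →-dec a ~? b))
  where
  infix 8 _~?_
  _~?_ : Decidable (SameBlock M)
  i ~? j = j ∈? lookup M i

isNC : ∀ {n} (π : NC n) → IsNC (blockVec π)
isNC (mkNC M p) = recompute (isNC? M) p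

nonZero : ∀ {n} → NC n → NonZero n
nonZero π = IsNC.nonZero (isNC π)

infix 4 _∼[_]_
_∼[_]_ : ∀ {n} → Fin n → NC n → Fin n → Set
i ∼[ π ] j = SameBlock (blockVec π) i j

module ∼ {n} (π : NC n) = IsEquivalence (IsNC.isEquivalence (isNC π))

infix 4 _≟_ _≤ᴺ_ _≤ᴺ?_
_≟_ : ∀ {n} → DecidableEquality (NC n)
mkNC M _ ≟ mkNC N _ =
  map′ (λ { refl → refl }) (cong blockVec)
       (Vec.≡-dec (Vec.≡-dec Bool._≟_) M N)

-- Reverse refinement: a subset is a union of blocks of π iff it
-- contains the π-block of each of its elements.

_≤ᴺ_ : ∀ {n} → NC n → NC n → Set
π ≤ᴺ σ = ∀ i j → j ∈ blockOf σ i → blockOf π j ⊆ blockOf σ i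

_≤ᴺ?_ : ∀ {n} → Decidable (_≤ᴺ_ {n})
π ≤ᴺ? σ = Fin.all? λ i → Fin.all? λ j →
  (j ∈? blockOf σ i) →-dec (blockOf π j ⊆? blockOf σ i)

≤ᴺ-refl : ∀ {n} (π : NC n) → π ≤ᴺ π
≤ᴺ-refl π i j i∼j j∼k = ∼.trans π i∼j j∼k

≤ᴺ-antisym : ∀ {n} {π σ : NC n} → π ≤ᴺ σ → σ ≤ᴺ π → π ≡ σ
≤ᴺ-antisym {n} {π@(mkNC M _)} {σ@(mkNC N _)} π≤σ σ≤π =
  equal (begin
    M                   ≡⟨ Vec.tabulate∘lookup M ⟨
    tabulate (lookup M) ≡⟨ Vec.tabulate-cong (λ i →
                             ⊆-antisym (π≤σ i i (∼.refl σ)) (σ≤π i i (∼.refl π))) ⟩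
    tabulate (lookup N) ≡⟨ Vec.tabulate∘lookup N ⟩
    N                   ∎)
  where
  open ≡-Reasoning
  equal : M ≡ N → π ≡ σ
  equal refl = refl

≤ᴺ-intro : ∀ {n} (π σ : NC n) →
           (∀ {i j} → i ∼[ π ] j → i ∼[ σ ] j) → π ≤ᴺ σ
≤ᴺ-intro π σ f i j i∼j j∼k = ∼.trans σ i∼j (f j∼k)

module _ {n} {r} {R : Rel (Fin n) r} (R? : Decidable R) where

  relVec : Vec (Subset n) n
  relVec = tabulate λ i → tabulate λ j → does (R? i j)

  private
    lookup-relVec : ∀ i j → lookup (lookup relVec i) j ≡ does (R? i j)
    lookup-relVec i j =
      trans (cong (λ v → lookup v j)
                  (Vec.lookup∘tabulate (λ i → tabulate λ j → does (R? i j)) i))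
            (Vec.lookup∘tabulate (λ j → does (R? i j)) j)

  relVec⁺ : ∀ {i j} → R i j → SameBlock relVec i j
  relVec⁺ {i} {j} p =
    Vec.lookup⇒[]= j _ (trans (lookup-relVec i j) (dec-true (R? i j) p))

  relVec⁻ : ∀ {i j} → SameBlock relVec i j → R i j
  relVec⁻ {i} {j} p with R? i j | trans (sym (lookup-relVec i j)) (Vec.[]=⇒lookup p)
  ... | yes q | _ = q
  ... | no  _ | ()

  fromRelation : .{{NonZero n}} → IsEquivalence R → NonCrossing _<_ R → NC n
  fromRelation {{z}} eq nc = mkNC relVec record
    { nonZero       = recompute (ℕ.nonZero? n) z
    ; isEquivalence = record
        { refl  = relVec⁺ E.refl
        ; sym   = λ p → relVec⁺ (E.sym (relVec⁻ p))
        ; trans = λ p q → relVec⁺ (E.trans (relVec⁻ p) (relVec⁻ q)) }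
    ; nonCrossing   = λ ab bc cd ac bd →
        relVec⁺ (nc ab bc cd (relVec⁻ ac) (relVec⁻ bd)) }
    where module E = IsEquivalence eq

𝟙 : ∀ n → .{{NonZero n}} → NC n
𝟙 n = fromRelation {R = λ _ _ → ⊤} (λ _ _ → yes tt) _ _

𝟘 : ∀ n → .{{NonZero n}} → NC n
𝟘 n = fromRelation {R = _≡_} Fin._≟_ ≡-isEquivalence
  λ { a<b b<c _ refl _ → contradiction (ℕ.<-trans a<b b<c) (ℕ.<-irrefl refl) }

≤ᴺ-𝟙 : ∀ {n} (π : NC n) .{{_ : NonZero n}} → π ≤ᴺ 𝟙 n
≤ᴺ-𝟙 {n} π = ≤ᴺ-intro π (𝟙 n) λ _ → relVec⁺ (λ _ _ → yes tt) tt

𝟘-≤ᴺ : ∀ {n} .{{_ : NonZero n}} (π : NC n) → 𝟘 n ≤ᴺ π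
𝟘-≤ᴺ {n} π = ≤ᴺ-intro (𝟘 n) π λ p →
  subst (_ ∼[ π ]_) (relVec⁻ Fin._≟_ p) (∼.refl π)

vectors : ∀ {a} {A : Set a} → List A → ∀ n → List (Vec A n)
vectors xs zero    = [ [] ]
vectors xs (suc n) = cartesianProductWith _∷_ xs (vectors xs n)

-- All vectors of subsets are enumerated without repetition and those
-- satisfying IsNC are kept, so each element of NC n occurs exactly once.

allNC : ∀ n → List (NC n)
allNC n = mapMaybe (λ M → Maybe.map (λ p → mkNC M p) (dec⇒maybe (isNC? M)))
                   (vectors (vectors (inside ∷ outside ∷ []) n) n)

record NonemptySubset (n : ℕ) : Set where
  constructor mkNonempty
  field
    subset    : Subset n
    .nonempty : Nonempty subset

open NonemptySubset public using (subset)

size : ∀ {n} → NonemptySubset n → ℕ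
size W = ∣ subset W ∣

-- Every block occurs exactly once in this list.

blocks : ∀ {n} → NC n → List (NonemptySubset n)
blocks {n} π = deduplicate _≟ˢ_
  (List.tabulate λ i → mkNonempty (blockOf π i) (i , ∼.refl π))
  where
  _≟ˢ_ : DecidableEquality (NonemptySubset n)
  mkNonempty V _ ≟ˢ mkNonempty W _ =
    map′ (λ { refl → refl }) (cong subset) (Vec.≡-dec Bool._≟_ V W)

-- The elements p₁ < ⋯ < p_m of W.

element : ∀ {n} (W : Subset n) → Fin ∣ W ∣ → Fin n
element (outside ∷ W) i       = suc (element W i)
element (inside  ∷ W) zero    = zero
element (inside  ∷ W) (suc i) = suc (element W i)

element-mono : ∀ {n} (W : Subset n) {i j} → i < j → element W i < element W j
element-mono (outside ∷ W) i<j = ℕ.s<s (element-mono W i<j)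
element-mono (inside  ∷ W) {zero}  {suc j} i<j = ℕ.z<s
element-mono (inside  ∷ W) {suc i} {suc j} i<j = ℕ.s<s (element-mono W (ℕ.s<s⁻¹ i<j))

size-nonZero : ∀ {n} (W : Subset n) → Nonempty W → NonZero ∣ W ∣
size-nonZero (inside  ∷ W) _               = _
size-nonZero (outside ∷ W) (_ , there x∈W) = size-nonZero W (_ , x∈W)

restrict : ∀ {n} → NC n → (W : NonemptySubset n) → NC (size W)
restrict π (mkNonempty W ne) =
  fromRelation {R = λ i j → element W i ∼[ π ] element W j}
    (λ i j → element W j ∈? blockOf π (element W i))
    {{size-nonZero W ne}}
    (record { refl = ∼.refl π ; sym = ∼.sym π ; trans = ∼.trans π })
    (λ ab bc cd → IsNC.nonCrossing (isNC π)
      (element-mono W ab) (element-mono W bc) (element-mono W cd))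

blocks-𝟘 : ∀ n .{{_ : NonZero n}} → All (λ W → size W ≡ 1) (blocks (𝟘 n))
blocks-𝟘 n = All.deduplicate⁺ _ (All.tabulate⁺ λ i →
  trans (cong ∣_∣ (⊆-antisym (forth i) (back i))) (∣⁅x⁆∣≡1 i))
  where
  forth : ∀ i → blockOf (𝟘 n) i ⊆ ⁅ i ⁆
  forth i p with refl ← relVec⁻ Fin._≟_ {i} p = x∈⁅x⁆ i

  back : ∀ i → ⁅ i ⁆ ⊆ blockOf (𝟘 n) i
  back i p with refl ← x∈⁅y⁆⇒x≡y i p = relVec⁺ Fin._≟_ {i} refl

-- inj₁ i is the point i and inj₂ i the point i′, ordered by
-- 1 < 1′ < 2 < 2′ < ⋯ < n < n′.

Points : ℕ → Set
Points n = Fin n ⊎ Fin n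

infix 4 _≺_
_≺_ : ∀ {n} → Rel (Points n) _
inj₁ i ≺ inj₁ j = i < j
inj₁ i ≺ inj₂ j = i ≤ j
inj₂ i ≺ inj₁ j = i < j
inj₂ i ≺ inj₂ j = i < j

UnionNonCrossing : ∀ {n} → NC n → NC n → Set
UnionNonCrossing π σ =
  NonCrossing _≺_ (Pointwise (λ i j → i ∼[ π ] j) (λ i j → i ∼[ σ ] j))

IsKreweras : ∀ {n} → NC n → NC n → Set
IsKreweras π σ =
  UnionNonCrossing π σ × (∀ τ → UnionNonCrossing π τ → τ ≤ᴺ σ)

-- Existence of the largest σ: i′ and j′ (i < j) belong to the same block iff
-- {i+1, …, j} is a union of blocks of π.  Since l ∈ {i+1, …, j} iff
-- exactly one of i < l and j < l holds, this says Linked π i j.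

module Saturation where

  before : ∀ {n} → Fin n → Fin n → Bool
  before i l = does (i Fin.<? l)

  Linked : ∀ {n} → NC n → Rel (Fin n) _
  Linked π i j = ∀ k l → k ∼[ π ] l →
    (before i k xor before j k) ≡ (before i l xor before j l)

  linked? : ∀ {n} (π : NC n) → Decidable (Linked π)
  linked? π i j = Fin.all? λ k → Fin.all? λ l →
    (l ∈? blockOf π k) →-dec
    ((before i k xor before j k) Bool.≟ (before i l xor before j l))

  xor-mid : ∀ a b c → (a xor b) xor (b xor c) ≡ a xor c
  xor-mid false false c = refl
  xor-mid false true  c = Bool.not-involutive c
  xor-mid true  false c = refl
  xor-mid true  true  c = refl

  linked-equivalence : ∀ {n} (π : NC n) → IsEquivalence (Linked π)
  linked-equivalence π = record
    { refl  = λ {i} k l _ → trans (Bool.xor-same (before i k))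
                                  (sym (Bool.xor-same (before i l)))
    ; sym   = λ {i j} p k l kl →
        trans (Bool.xor-comm (before j k) (before i k))
              (trans (p k l kl) (Bool.xor-comm (before i l) (before j l)))
    ; trans = λ {i j m} p q k l kl →
        trans (sym (xor-mid (before i k) (before j k) (before m k)))
              (trans (cong₂ _xor_ (p k l kl) (q k l kl))
                     (xor-mid (before i l) (before j l) (before m l))) }

  before-true : ∀ {n} {i l : Fin n} → i < l → before i l ≡ true
  before-true {i = i} {l} = dec-true (i Fin.<? l)

  before-false : ∀ {n} {i l : Fin n} → l ≤ i → before i l ≡ false
  before-false {i = i} {l} l≤i = dec-false (i Fin.<? l) (ℕ.≤⇒≯ l≤i)

  before-anti : ∀ {n} {i j : Fin n} l → i < j → before i l ≡ false → before j l ≡ false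
  before-anti {i = i} {j} l i<j p with Fin.<-cmp i l
  ... | tri< i<l _ _ = contradiction (trans (sym p) (before-true {i = i} {l} i<l)) λ ()
  ... | tri≈ _ i≡l _ = before-false {i = j} {l} (subst (_≤ j) i≡l (ℕ.<⇒≤ i<j))
  ... | tri> _ _ l<i = before-false {i = j} {l} (ℕ.<⇒≤ (ℕ.<-trans l<i i<j))

  xor-chain : ∀ a b c d → (a ≡ false → b ≡ false) → (b ≡ false → c ≡ false) →
              (c ≡ false → d ≡ false) →
              a xor b ≡ (a xor c) ∧ not (b xor d)
  xor-chain false b c d p q r with refl ← p refl with refl ← q refl = refl
  xor-chain true  false c d p q r with refl ← q refl with refl ← r refl = refl
  xor-chain true  true  false d p q r with refl ← r refl = refl
  xor-chain true  true  true  d p q r = refl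

  linked-nonCrossing : ∀ {n} (π : NC n) → NonCrossing _<_ (Linked π)
  linked-nonCrossing π {a} {b} {c} {d} a<b b<c c<d ac bd k l kl =
    trans (chain k)
      (trans (cong₂ (λ x y → x ∧ not y) (ac k l kl) (bd k l kl)) (sym (chain l)))
    where
    chain : ∀ m → before a m xor before b m
                ≡ (before a m xor before c m) ∧ not (before b m xor before d m)
    chain m = xor-chain _ _ _ _ (before-anti m a<b) (before-anti m b<c) (before-anti m c<d)

  in-interval : ∀ {n} {i j l : Fin n} → i < l → l ≤ j → before i l xor before j l ≡ true
  in-interval {i = i} {j} {l} p q
    rewrite before-true {i = i} {l} p | before-false {i = j} {l} q = refl

  below-interval : ∀ {n} {i j l : Fin n} → l ≤ i → l ≤ j → before i l xor before j l ≡ false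
  below-interval {i = i} {j} {l} p q
    rewrite before-false {i = i} {l} p | before-false {i = j} {l} q = refl

  above-interval : ∀ {n} {i j l : Fin n} → i < l → j < l → before i l xor before j l ≡ false
  above-interval {i = i} {j} {l} p q
    rewrite before-true {i = i} {l} p | before-true {i = j} {l} q = refl

  position : ∀ {n} {i j : Fin n} → i < j → ∀ l →
             (i < l × l ≤ j × before i l xor before j l ≡ true) ⊎
             ((l ≤ i ⊎ j < l) × before i l xor before j l ≡ false)
  position {i = i} {j} i<j l with i Fin.<? l | j Fin.<? l
  ... | no  i≮l | _       = inj₂ (inj₁ (ℕ.≮⇒≥ i≮l) ,
                                  below-interval {i = i} {j} (ℕ.≮⇒≥ i≮l)
                                    (ℕ.≤-trans (ℕ.≮⇒≥ i≮l) (ℕ.<⇒≤ i<j)))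
  ... | yes i<l | no  j≮l = inj₁ (i<l , ℕ.≮⇒≥ j≮l , in-interval i<l (ℕ.≮⇒≥ j≮l))
  ... | yes i<l | yes j<l = inj₂ (inj₂ j<l , above-interval {i = i} {j} i<l j<l)

  clash : ∀ {x y : Bool} → x ≡ true → x ≡ y → y ≡ false → ⊥
  clash refl refl ()

open Saturation

Kr-exists : ∀ {n} (π : NC n) → Σ[ σ ∈ NC n ] IsKreweras π σ
Kr-exists {n} π = κ , (λ {a} {b} {c} {d} → union {a} {b} {c} {d}) , largest
  where
  κ : NC n
  κ = fromRelation (linked? π) {{nonZero π}} (linked-equivalence π) (linked-nonCrossing π)

  union : UnionNonCrossing π κ
  union {inj₁ a} {inj₁ b} ab bc cd (inj₁ ac) (inj₁ bd) =
    inj₁ (IsNC.nonCrossing (isNC π) ab bc cd ac bd)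
  union {inj₂ a} {inj₂ b} ab bc cd (inj₂ ac) (inj₂ bd) =
    inj₂ (IsNC.nonCrossing (isNC κ) ab bc cd ac bd)
  union {inj₁ a} {inj₂ b} {inj₁ c} {inj₂ d} ab bc cd (inj₁ ac) (inj₂ bd) =
    ⊥-elim (clash (in-interval bc cd) (relVec⁻ (linked? π) bd c a (∼.sym π ac))
                  (below-interval {i = b} {d} ab
                    (ℕ.≤-trans ab (ℕ.<⇒≤ (ℕ.<-≤-trans bc cd)))))
  union {inj₂ a} {inj₁ b} {inj₂ c} {inj₁ d} ab bc cd (inj₂ ac) (inj₁ bd) =
    ⊥-elim (clash (in-interval ab bc) (relVec⁻ (linked? π) ac b d bd)
                  (above-interval {i = a} {c} (ℕ.<-≤-trans ab (ℕ.≤-trans bc (ℕ.<⇒≤ cd))) cd))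

  module _ (τ : NC n) (u : UnionNonCrossing π τ) where

    apart : ∀ {k l i j} → i < k → k ≤ j → l ≤ i ⊎ j < l →
            k ∼[ π ] l → i ∼[ τ ] j → ⊥
    apart {k} {l} {i} {j} i<k k≤j (inj₁ l≤i) kl ij
      with u {inj₁ l} {inj₂ i} {inj₁ k} {inj₂ j} l≤i i<k k≤j (inj₁ (∼.sym π kl)) (inj₂ ij)
    ... | ()
    apart {k} {l} {i} {j} i<k k≤j (inj₂ j<l) kl ij
      with u {inj₂ i} {inj₁ k} {inj₂ j} {inj₁ l} i<k k≤j j<l (inj₂ ij) (inj₁ kl)
    ... | ()

    ordered : ∀ {i j} → i < j → i ∼[ τ ] j → Linked π i j
    ordered i<j ij k l kl with position i<j k | position i<j l
    ... | inj₁ (_ , _ , p)     | inj₁ (_ , _ , q)     = trans p (sym q)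
    ... | inj₂ (_ , p)         | inj₂ (_ , q)         = trans p (sym q)
    ... | inj₁ (i<k , k≤j , _) | inj₂ (out , _)       = ⊥-elim (apart i<k k≤j out kl ij)
    ... | inj₂ (out , _)       | inj₁ (i<l , l≤j , _) = ⊥-elim (apart i<l l≤j out (∼.sym π kl) ij)

    linked : ∀ {i j} → i ∼[ τ ] j → Linked π i j
    linked {i} {j} ij with Fin.<-cmp i j
    ... | tri< i<j _ _ = ordered i<j ij
    ... | tri≈ _ refl _ = IsEquivalence.refl (linked-equivalence π) {i}
    ... | tri> _ _ j<i = IsEquivalence.sym (linked-equivalence π) {j} {i} (ordered j<i (∼.sym τ ij))

    largest : τ ≤ᴺ κ
    largest = ≤ᴺ-intro τ κ λ ij → relVec⁺ (linked? π) (linked ij)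

opaque

  Kr : ∀ {n} → NC n → NC n
  Kr π = proj₁ (Kr-exists π)

  Kr-isKreweras : ∀ {n} (π : NC n) → IsKreweras π (Kr π)
  Kr-isKreweras π = proj₂ (Kr-exists π)

Kr-𝟙 : ∀ {n} .{{_ : NonZero n}} → Kr (𝟙 n) ≡ 𝟘 n
Kr-𝟙 {n} = ≤ᴺ-antisym (≤ᴺ-intro κ (𝟘 n) λ p → relVec⁺ Fin._≟_ (equal p)) (𝟘-≤ᴺ κ)
  where
  κ = Kr (𝟙 n)

  one : ∀ i j → i ∼[ 𝟙 n ] j
  one i j = relVec⁺ (λ _ _ → yes tt) tt

  apart : ∀ {i j} → i < j → i ∼[ κ ] j → ⊥
  apart {i} {j} i<j ij
    with proj₁ (Kr-isKreweras (𝟙 n)) {inj₁ i} {inj₂ i} {inj₁ j} {inj₂ j}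
           (ℕ.≤-refl {toℕ i}) i<j (ℕ.≤-refl {toℕ j}) (inj₁ (one i j)) (inj₂ ij)
  ... | ()

  equal : ∀ {i j} → i ∼[ κ ] j → i ≡ j
  equal {i} {j} ij with Fin.<-cmp i j
  ... | tri< i<j _ _ = ⊥-elim (apart i<j ij)
  ... | tri≈ _ i≡j _ = i≡j
  ... | tri> _ _ j<i = ⊥-elim (apart j<i (∼.sym κ ij))

-- K plays the role of ℂ: only its commutative ring structure enters, and
-- the library has no complex numbers.

module Over {c ℓ} (K : CommutativeRing c ℓ) where

  private module K = CommutativeRing K

  record CommutativeAlgebra a ℓᵃ : Set (c ⊔ ℓ ⊔ lsuc (a ⊔ ℓᵃ)) where
    field
      commutativeRing : CommutativeRing a ℓᵃ

    open CommutativeRing commutativeRing public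

    field
      fromK                    : K.Carrier → Carrier
      fromK-isRingHomomorphism :
        RingMorphisms.IsRingHomomorphism K.rawRing rawRing fromK

    ∑ ∏ : ∀ {x} {X : Set x} → List X → (X → Carrier) → Carrier
    ∑ xs f = foldr (λ x s → f x + s) 0# xs
    ∏ xs f = foldr (λ x p → f x * p) 1# xs

  open CommutativeAlgebra using (Carrier)

  Kᵃ : CommutativeAlgebra c ℓ
  Kᵃ = record
    { commutativeRing          = K
    ; fromK                    = λ k → k
    ; fromK-isRingHomomorphism = Identity.isRingHomomorphism K.rawRing K.refl
    }

  record AlgHom {a ℓᵃ b ℓᵇ} (A : CommutativeAlgebra a ℓᵃ) (B : CommutativeAlgebra b ℓᵇ)
                : Set (c ⊔ a ⊔ ℓᵃ ⊔ b ⊔ ℓᵇ) where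
    private
      module A = CommutativeAlgebra A
      module B = CommutativeAlgebra B
    field
      ⟦_⟧                : A.Carrier → B.Carrier
      isRingHomomorphism : RingMorphisms.IsRingHomomorphism A.rawRing B.rawRing ⟦_⟧
      fromK-homo         : ∀ k → ⟦ A.fromK k ⟧ B.≈ B.fromK k

    open RingMorphisms.IsRingHomomorphism isRingHomomorphism public

  open AlgHom using (⟦_⟧)

  infixr 9 _∘ᵃ_
  _∘ᵃ_ : ∀ {a ℓᵃ b ℓᵇ d ℓᵈ}
           {A : CommutativeAlgebra a ℓᵃ} {B : CommutativeAlgebra b ℓᵇ}
           {D : CommutativeAlgebra d ℓᵈ} →
         AlgHom B D → AlgHom A B → AlgHom A D
  _∘ᵃ_ {D = D} g f = record
    { ⟦_⟧                = λ x → ⟦ g ⟧ (⟦ f ⟧ x)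
    ; isRingHomomorphism =
        Composition.isRingHomomorphism D.trans
          (AlgHom.isRingHomomorphism f) (AlgHom.isRingHomomorphism g)
    ; fromK-homo         = λ k →
        D.trans (AlgHom.⟦⟧-cong g (AlgHom.fromK-homo f k)) (AlgHom.fromK-homo g k)
    }
    where module D = CommutativeAlgebra D

  -- The commutative algebra generated by G subject to the relations R.

  infixl 7 _:*_
  infixl 6 _:+_
  infix  8 :-_

  data Term {g} (G : Set g) : Set (c ⊔ g) where
    gen       : G → Term G
    con       : K.Carrier → Term G
    _:+_ _:*_ : Term G → Term G → Term G
    :-_       : Term G → Term G

  module Presentation {g r} {G : Set g} (R : Rel (Term G) r) where

    infix 4 _≋_
    data _≋_ : Rel (Term G) (c ⊔ ℓ ⊔ g ⊔ r) where
      relation     : ∀ {x y} → R x y → x ≋ y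
      ≋-refl       : ∀ {x} → x ≋ x
      ≋-sym        : ∀ {x y} → x ≋ y → y ≋ x
      ≋-trans      : ∀ {x y z} → x ≋ y → y ≋ z → x ≋ z
      +-cong       : ∀ {x x′ y y′} → x ≋ x′ → y ≋ y′ → x :+ y ≋ x′ :+ y′
      *-cong       : ∀ {x x′ y y′} → x ≋ x′ → y ≋ y′ → x :* y ≋ x′ :* y′
      -‿cong       : ∀ {x x′} → x ≋ x′ → :- x ≋ :- x′
      +-assoc      : ∀ x y z → (x :+ y) :+ z ≋ x :+ (y :+ z)
      +-comm       : ∀ x y → x :+ y ≋ y :+ x
      +-identityˡ  : ∀ x → con K.0# :+ x ≋ x
      -‿inverseˡ   : ∀ x → :- x :+ x ≋ con K.0#
      *-assoc      : ∀ x y z → (x :* y) :* z ≋ x :* (y :* z)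
      *-comm       : ∀ x y → x :* y ≋ y :* x
      *-identityˡ  : ∀ x → con K.1# :* x ≋ x
      *-distribˡ-+ : ∀ x y z → x :* (y :+ z) ≋ x :* y :+ x :* z
      con-cong     : ∀ {k l} → k K.≈ l → con k ≋ con l
      con-+        : ∀ k l → con (k K.+ l) ≋ con k :+ con l
      con-*        : ∀ k l → con (k K.* l) ≋ con k :* con l
      con-neg      : ∀ k → con (K.- k) ≋ :- con k

    presented : CommutativeAlgebra (c ⊔ g) (c ⊔ ℓ ⊔ g ⊔ r)
    presented = record
      { commutativeRing = record
        { Carrier = Term G
        ; _≈_ = _≋_
        ; _+_ = _:+_
        ; _*_ = _:*_
        ; -_  = :-_
        ; 0#  = con K.0#
        ; 1#  = con K.1#
        ; isCommutativeRing = record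
          { isRing = record
            { +-isAbelianGroup = record
              { isGroup = record
                { isMonoid = record
                  { isSemigroup = record
                    { isMagma = record
                      { isEquivalence = record
                        { refl = ≋-refl ; sym = ≋-sym ; trans = ≋-trans }
                      ; ∙-cong = +-cong }
                    ; assoc = +-assoc }
                  ; identity = +-identityˡ ,
                      λ x → ≋-trans (+-comm x _) (+-identityˡ x) }
                ; inverse = -‿inverseˡ , λ x → ≋-trans (+-comm x _) (-‿inverseˡ x)
                ; ⁻¹-cong = -‿cong }
              ; comm = +-comm }
            ; *-cong = *-cong
            ; *-assoc = *-assoc
            ; *-identity = *-identityˡ ,
                λ x → ≋-trans (*-comm x _) (*-identityˡ x)
            ; distrib = *-distribˡ-+ , λ x y z →
                ≋-trans (*-comm (y :+ z) x)
                  (≋-trans (*-distribˡ-+ x y z) (+-cong (*-comm x y) (*-comm x z))) }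
          ; *-comm = *-comm } }
      ; fromK = con
      ; fromK-isRingHomomorphism = record
        { isSemiringHomomorphism = record
          { isNearSemiringHomomorphism = record
            { +-isMonoidHomomorphism = record
              { isMagmaHomomorphism = record
                { isRelHomomorphism = record { cong = con-cong }
                ; homo = con-+ }
              ; ε-homo = ≋-refl }
            ; *-homo = con-* }
          ; 1#-homo = ≋-refl }
        ; -‿homo = con-neg }
      }

    module _ {b ℓᵇ} (B : CommutativeAlgebra b ℓᵇ) (f : G → Carrier B) where

      private
        module B = CommutativeAlgebra B
        module ι = RingMorphisms.IsRingHomomorphism B.fromK-isRingHomomorphism

      evaluate : Term G → B.Carrier
      evaluate (gen x)  = f x
      evaluate (con k)  = B.fromK k
      evaluate (x :+ y) = evaluate x B.+ evaluate y
      evaluate (x :* y) = evaluate x B.* evaluate y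
      evaluate (:- x)   = B.- evaluate x

      module _ (f-R : ∀ {x y} → R x y → evaluate x B.≈ evaluate y) where

        evaluate-cong : ∀ {x y} → x ≋ y → evaluate x B.≈ evaluate y
        evaluate-cong (relation p)         = f-R p
        evaluate-cong ≋-refl               = B.refl
        evaluate-cong (≋-sym p)            = B.sym (evaluate-cong p)
        evaluate-cong (≋-trans p q)        = B.trans (evaluate-cong p) (evaluate-cong q)
        evaluate-cong (+-cong p q)         = B.+-cong (evaluate-cong p) (evaluate-cong q)
        evaluate-cong (*-cong p q)         = B.*-cong (evaluate-cong p) (evaluate-cong q)
        evaluate-cong (-‿cong p)           = B.-‿cong (evaluate-cong p)
        evaluate-cong (+-assoc x y z)      = B.+-assoc _ _ _
        evaluate-cong (+-comm x y)         = B.+-comm _ _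
        evaluate-cong (+-identityˡ x)      = B.trans (B.+-congʳ ι.0#-homo) (B.+-identityˡ _)
        evaluate-cong (-‿inverseˡ x)       = B.trans (B.-‿inverseˡ _) (B.sym ι.0#-homo)
        evaluate-cong (*-assoc x y z)      = B.*-assoc _ _ _
        evaluate-cong (*-comm x y)         = B.*-comm _ _
        evaluate-cong (*-identityˡ x)      = B.trans (B.*-congʳ ι.1#-homo) (B.*-identityˡ _)
        evaluate-cong (*-distribˡ-+ x y z) = B.distribˡ _ _ _
        evaluate-cong (con-cong p)         = ι.⟦⟧-cong p
        evaluate-cong (con-+ k l)          = ι.+-homo k l
        evaluate-cong (con-* k l)          = ι.*-homo k l
        evaluate-cong (con-neg k)          = ι.-‿homo k

        extend : AlgHom presented B
        extend = record
          { ⟦_⟧ = evaluate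
          ; isRingHomomorphism = record
            { isSemiringHomomorphism = record
              { isNearSemiringHomomorphism = record
                { +-isMonoidHomomorphism = record
                  { isMagmaHomomorphism = record
                    { isRelHomomorphism = record { cong = evaluate-cong }
                    ; homo = λ _ _ → B.refl }
                  ; ε-homo = ι.0#-homo }
                ; *-homo = λ _ _ → B.refl }
              ; 1#-homo = ι.1#-homo }
            ; -‿homo = λ _ → B.refl }
          ; fromK-homo = λ _ → B.refl
          }

  -- The polynomial algebra is the free commutative algebra: it is
  -- presented without relations.

  Polynomial : ∀ {i} → Set i → CommutativeAlgebra (c ⊔ i) (c ⊔ ℓ ⊔ i)
  Polynomial I = Presentation.presented {G = I} (λ _ _ → ⊥)

  polyHom : ∀ {i} {I : Set i} {b ℓᵇ} (B : CommutativeAlgebra b ℓᵇ) →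
            (I → Carrier B) → AlgHom (Polynomial I) B
  polyHom B f = Presentation.extend (λ _ _ → ⊥) B f (λ ())

  module Tensor {a ℓᵃ b ℓᵇ} (A : CommutativeAlgebra a ℓᵃ) (B : CommutativeAlgebra b ℓᵇ) where

    private
      module A = CommutativeAlgebra A
      module B = CommutativeAlgebra B

    infix 8 _⊗_
    _⊗_ : A.Carrier → B.Carrier → Term (A.Carrier × B.Carrier)
    x ⊗ y = gen (x , y)

    -- By *-⊗ and 1⊗1 every element of the algebra presented below is a
    -- sum of pure tensors; the other relations are the bilinear ones.

    data Relation : Rel (Term (A.Carrier × B.Carrier)) (c ⊔ a ⊔ ℓᵃ ⊔ b ⊔ ℓᵇ) where
      ⊗-cong  : ∀ {x x′ y y′} → x A.≈ x′ → y B.≈ y′ → Relation (x ⊗ y) (x′ ⊗ y′)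
      +-⊗     : ∀ x x′ y → Relation ((x A.+ x′) ⊗ y) (x ⊗ y :+ x′ ⊗ y)
      ⊗-+     : ∀ x y y′ → Relation (x ⊗ (y B.+ y′)) (x ⊗ y :+ x ⊗ y′)
      scalarˡ : ∀ k x y → Relation ((A.fromK k A.* x) ⊗ y) (con k :* x ⊗ y)
      scalarʳ : ∀ k x y → Relation (x ⊗ (B.fromK k B.* y)) (con k :* x ⊗ y)
      *-⊗     : ∀ x x′ y y′ → Relation ((x A.* x′) ⊗ (y B.* y′)) (x ⊗ y :* x′ ⊗ y′)
      1⊗1     : Relation (A.1# ⊗ B.1#) (con K.1#)

  infixr 7 _⊗ᵃ_
  _⊗ᵃ_ : ∀ {a ℓᵃ b ℓᵇ} → CommutativeAlgebra a ℓᵃ → CommutativeAlgebra b ℓᵇ →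
         CommutativeAlgebra (c ⊔ a ⊔ b) (c ⊔ ℓ ⊔ a ⊔ ℓᵃ ⊔ b ⊔ ℓᵇ)
  A ⊗ᵃ B = Presentation.presented (Tensor.Relation A B)

  -- χ₁ ⊗ χ₂, with K ⊗ K identified with K.

  module _ {a ℓᵃ b ℓᵇ} {A : CommutativeAlgebra a ℓᵃ} {B : CommutativeAlgebra b ℓᵇ} where

    private
      module A = CommutativeAlgebra A
      module B = CommutativeAlgebra B

    _⊗ᵡ_ : AlgHom A Kᵃ → AlgHom B Kᵃ → AlgHom (A ⊗ᵃ B) Kᵃ
    χ₁ ⊗ᵡ χ₂ = extend Kᵃ pair respects
      where
      open Presentation (Tensor.Relation A B) using (evaluate; extend)
      open Tensor A B
      open import Algebra.Properties.CommutativeSemigroup K.*-commutativeSemigroup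
        using (interchange; x∙yz≈y∙xz)
      module χ₁ = AlgHom χ₁
      module χ₂ = AlgHom χ₂

      pair : A.Carrier × B.Carrier → K.Carrier
      pair (x , y) = χ₁.⟦ x ⟧ K.* χ₂.⟦ y ⟧

      respects : ∀ {x y} → Relation x y → evaluate Kᵃ pair x K.≈ evaluate Kᵃ pair y
      respects (⊗-cong p q)     = K.*-cong (χ₁.⟦⟧-cong p) (χ₂.⟦⟧-cong q)
      respects (+-⊗ x x′ y)     = K.trans (K.*-congʳ (χ₁.+-homo x x′)) (K.distribʳ _ _ _)
      respects (⊗-+ x y y′)     = K.trans (K.*-congˡ (χ₂.+-homo y y′)) (K.distribˡ _ _ _)
      respects (scalarˡ k x y)  =
        K.trans (K.*-congʳ (K.trans (χ₁.*-homo _ x) (K.*-congʳ (χ₁.fromK-homo k))))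
                (K.*-assoc _ _ _)
      respects (scalarʳ k x y)  =
        K.trans (K.*-congˡ (K.trans (χ₂.*-homo _ y) (K.*-congʳ (χ₂.fromK-homo k))))
                (x∙yz≈y∙xz _ _ _)
      respects (*-⊗ x x′ y y′)  =
        K.trans (K.*-cong (χ₁.*-homo x x′) (χ₂.*-homo y y′)) (interchange _ _ _ _)
      respects 1⊗1              =
        K.trans (K.*-cong χ₁.1#-homo χ₂.1#-homo) (K.*-identityˡ _)

  record RawBialgebra a ℓᵃ : Set (lsuc (c ⊔ ℓ ⊔ a ⊔ ℓᵃ)) where
    field
      algebra : CommutativeAlgebra a ℓᵃ
      Δ       : AlgHom algebra (algebra ⊗ᵃ algebra)
      ε       : AlgHom algebra Kᵃ

  Character : ∀ {a ℓᵃ} → RawBialgebra a ℓᵃ → Set (c ⊔ ℓ ⊔ a ⊔ ℓᵃ)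
  Character H = AlgHom (RawBialgebra.algebra H) Kᵃ

  -- Only the multiplication and the unit of the group of characters are
  -- recorded; inverses are determined by them (see IsInverse).

  𝕏 : ∀ {a ℓᵃ} → RawBialgebra a ℓᵃ → RawMonoid (c ⊔ ℓ ⊔ a ⊔ ℓᵃ) (ℓ ⊔ a)
  𝕏 H = record
    { Carrier = Character H
    ; _≈_     = λ χ₁ χ₂ → ∀ x → ⟦ χ₁ ⟧ x K.≈ ⟦ χ₂ ⟧ x
    ; _∙_     = λ χ₁ χ₂ → (χ₁ ⊗ᵡ χ₂) ∘ᵃ RawBialgebra.Δ H
    ; ε       = RawBialgebra.ε H
    }

  IsInverse : ∀ {m ℓᵐ} (M : RawMonoid m ℓᵐ) → Rel (RawMonoid.Carrier M) ℓᵐ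
  IsInverse M x y = (x ∙ y ≈ ε) × (y ∙ x ≈ ε)
    where open RawMonoid M

  record IndexT : Set where
    constructor index
    field
      {n}  : ℕ
      π    : NC n
      .π≢𝟙 : π ≢ 𝟙 n {{nonZero π}}

  𝒯ᵃ : CommutativeAlgebra c (c ⊔ ℓ)
  𝒯ᵃ = Polynomial IndexT

  X : ∀ {n} → NC n → Carrier 𝒯ᵃ
  X {n} π with π ≟ 𝟙 n {{nonZero π}}
  ... | yes _   = CommutativeAlgebra.1# 𝒯ᵃ
  ... | no  π≢𝟙 = gen (index π π≢𝟙)

  𝒯 : RawBialgebra c (c ⊔ ℓ)
  𝒯 = record
    { algebra = 𝒯ᵃ
    ; Δ = polyHom (𝒯ᵃ ⊗ᵃ 𝒯ᵃ) λ (index {n} π _) →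
            CommutativeAlgebra.∑ (𝒯ᵃ ⊗ᵃ 𝒯ᵃ) (filter (π ≤ᴺ?_) (allNC n)) λ σ →
              CommutativeAlgebra.∏ 𝒯ᵃ (blocks σ) (λ W → X (restrict π W)) ⊗ X σ
    ; ε = polyHom Kᵃ (λ _ → K.0#)
    }
    where open Tensor 𝒯ᵃ 𝒯ᵃ

  record IndexSym : Set where
    constructor index
    field
      n    : ℕ
      .n≥2 : 2 ℕ.≤ n

  Symᵃ : CommutativeAlgebra c (c ⊔ ℓ)
  Symᵃ = Polynomial IndexSym

  -- Only used for n ≥ 1, so that the second case is the convention Y 1 = 1.

  Y : ℕ → Carrier Symᵃ
  Y n with 2 ℕ.≤? n
  ... | yes n≥2 = gen (index n n≥2)
  ... | no  _   = CommutativeAlgebra.1# Symᵃ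

  Yᴺ : ∀ {n} → NC n → Carrier Symᵃ
  Yᴺ π = CommutativeAlgebra.∏ Symᵃ (blocks π) (λ W → Y (size W))

  Sym : RawBialgebra c (c ⊔ ℓ)
  Sym = record
    { algebra = Symᵃ
    ; Δ = polyHom (Symᵃ ⊗ᵃ Symᵃ) λ (index n _) →
            CommutativeAlgebra.∑ (Symᵃ ⊗ᵃ Symᵃ) (allNC n) λ π → Yᴺ π ⊗ Yᴺ (Kr π)
    ; ε = polyHom Kᵃ (λ _ → K.0#)
    }
    where open Tensor Symᵃ Symᵃ

  Ψ : AlgHom 𝒯ᵃ Symᵃ
  Ψ = polyHom Symᵃ λ (index π _) → Yᴺ (Kr π)

  Ψ-X : ∀ {n} (π : NC n) → CommutativeAlgebra._≈_ Symᵃ (⟦ Ψ ⟧ (X π)) (Yᴺ (Kr π))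
  Ψ-X {n} π with π ≟ 𝟙 n {{nonZero π}}
  ... | no  _    = CommutativeAlgebra.refl Symᵃ
  ... | yes refl = S.sym (S.trans (S.reflexive (cong Yᴺ (Kr-𝟙 {n}))) (product-1 (blocks-𝟘 n)))
    where
    module S = CommutativeAlgebra Symᵃ
    instance
      n≢0 : NonZero n
      n≢0 = nonZero π

    product-1 : ∀ {Ws : List (NonemptySubset n)} → All (λ W → size W ≡ 1) Ws →
                S.∏ Ws (λ W → Y (size W)) S.≈ S.1#
    product-1 []       = S.refl
    product-1 (p ∷ ps) = S.trans (S.*-cong (S.reflexive (cong Y p)) (product-1 ps))
                                 (S.*-identityˡ S.1#)

  Ψ* : Character Sym → Character 𝒯
  Ψ* χ = χ ∘ᵃ Ψ

  record NC² : Set where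
    constructor _≼_by_
    field
      {n}  : ℕ
      π σ  : NC n
      .π≤σ : π ≤ᴺ σ

  [_,𝟙] : ∀ {n} → NC n → NC²
  [_,𝟙] {n} π = π ≼ 𝟙 n {{nonZero π}} by ≤ᴺ-𝟙 π {{nonZero π}}

  [𝟘,_] : ∀ {n} → NC n → NC²
  [𝟘,_] {n} π = 𝟘 n {{nonZero π}} ≼ π by 𝟘-≤ᴺ {{nonZero π}} π

  record 𝒢~ : Set (c ⊔ ℓ) where
    field
      fun            : NC² → K.Carrier
      diagonal       : ∀ {n} (π : NC n) → fun (π ≼ π by ≤ᴺ-refl π) K.≈ K.1#
      factorisation  : ∀ {n} (π σ : NC n) (π≤σ : π ≤ᴺ σ) →
        fun (π ≼ σ by π≤σ) K.≈
        CommutativeAlgebra.∏ Kᵃ (blocks σ) (λ W → fun [ restrict π W ,𝟙])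

  record 𝒢 : Set (c ⊔ ℓ) where
    field
      g~             : 𝒢~
    open 𝒢~ g~ public
    field
      multiplicative : ∀ {n} (π : NC n) → fun [ π ,𝟙] K.≈ fun [𝟘, Kr π ]

  -- The groups of characters are identified with 𝒢~ and 𝒢 by g ↦ χ g and
  -- f ↦ χ̂ f; under these, the inclusion of 𝒢 into 𝒢~ is 𝒢.g~.

  χ : 𝒢~ → Character 𝒯
  χ g = polyHom Kᵃ λ (index π _) → 𝒢~.fun g [ π ,𝟙]

  χ̂ : 𝒢 → Character Sym
  χ̂ f = polyHom Kᵃ λ (index n n≥2) →
    𝒢.fun f [ 𝟘 n {{ℕ.>-nonZero (ℕ.≤-trans (ℕ.s≤s ℕ.z≤n) n≥2)}} ,𝟙]

  χ-X : ∀ (g : 𝒢~) {n} (π : NC n) → ⟦ χ g ⟧ (X π) K.≈ 𝒢~.fun g [ π ,𝟙]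
  χ-X g {n} π with π ≟ 𝟙 n {{nonZero π}}
  ... | no  _    = K.refl
  ... | yes refl = K.sym (𝒢~.diagonal g π)

  χ̂-Y : ∀ (f : 𝒢) n .{{_ : NonZero n}} → ⟦ χ̂ f ⟧ (Y n) K.≈ 𝒢.fun f [ 𝟘 n ,𝟙]
  χ̂-Y f (suc zero)    = K.sym (𝒢.diagonal f (𝟘 1))
  χ̂-Y f (suc (suc n)) = K.refl

{-# OPTIONS --safe #-}

-- For ρ ≤ τ the complement of ρ relative to τ, taken block by block in τ, is
-- τ ∧ Kr ρ.  The relative complement is an involution up to orientation, which
-- gives the bijection σ ↦ σ ∧ Kr π from [π, 1] onto [0, Kr π] and the identity
-- Kr σ = Kr π ∧ Kr (σ ∧ Kr π).  Now evaluate both characters at X_π.  The value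
-- of χ₁ * χ₂ at ∏_{W ∈ Kr π} Y_|W| expands to a sum over ρ ≤ Kr π of
-- χ₁(Y_ρ) χ₂(Y_{Kr π ∧ Kr ρ}), and that of Ψ*χ₁ * Ψ*χ₂ at X_π is the sum over
-- σ ≥ π of χ₁(Y_{σ ∧ Kr π}) χ₂(Y_{Kr σ}); the bijection matches the terms.
-- Ψ* is injective because Kr 0 = 1, so that Ψ sends X_{0_n} to Y_n.

module Submission where

open import Algebra.Bundles using (CommutativeMonoid; CommutativeRing; RawMonoid)
open import Algebra.Morphism.Structures using (module MonoidMorphisms)
open import Data.Bool.Base using (Bool; true; false; not; _∧_; _xor_)
import Data.Bool.Properties as Bool
open import Data.Empty using (⊥; ⊥-elim)
open import Data.Fin.Base using (Fin; zero; suc; _<_; fromℕ<)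
open import Data.Fin.Induction using (spo-wellFounded; spo-noetherian)
import Data.Fin.Properties as Fin
open import Data.Fin.Subset as Subset using (Subset; inside; outside; ∣_∣)
open import Data.Fin.Subset.Properties using (_∈?_; ⊆-antisym; ⊆-max; ∣⊤∣≡n)
open import Data.List.Base
  using (List; []; _∷_; [_]; _++_; foldr; map; mapMaybe; concatMap; filter; cartesianProductWith)
open import Data.List.Membership.Propositional using (_∈_; find; lose)
import Data.List.Membership.Propositional.Properties as List
open import Data.List.Membership.Propositional.Properties.WithK using (unique∧set⇒bag)
open import Data.List.Relation.Binary.BagAndSetEquality using (∼bag⇒↭)
open import Data.List.Relation.Binary.Disjoint.Propositional using (Disjoint)
open import Data.List.Relation.Binary.Permutation.Propositional
  using (_↭_; prep; swap) renaming (refl to ↭-refl; trans to ↭-trans)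
open import Data.List.Relation.Unary.All as All using (All; []; _∷_)
import Data.List.Relation.Unary.All.Properties as All
open import Data.List.Relation.Unary.AllPairs using (AllPairs; []; _∷_)
import Data.List.Relation.Unary.AllPairs.Properties as AllPairs
open import Data.List.Relation.Unary.Any using (here; there; any?)
open import Data.List.Relation.Unary.Unique.Propositional using (Unique)
import Data.List.Relation.Unary.Unique.Propositional.Properties as Unique
import Data.List.Relation.Unary.Unique.DecPropositional.Properties as DecUnique
open import Data.Maybe.Base as Maybe using (Maybe; just; nothing)
open import Data.Nat.Base as ℕ using (ℕ; suc; zero; NonZero)
import Data.Nat.Properties as ℕ
open import Data.Product.Base using (Σ-syntax; ∃; _×_; _,_; proj₁; proj₂)
open import Data.Unit.Base using (tt)
open import Data.Vec.Base using (Vec; []; _∷_; here; there)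
open import Data.Vec.Properties using (∷-injective)
open import Function.Base using (_∘_; flip)
open import Function.Bundles using (mk⇔)
open import Induction.WellFounded using (Acc; acc)
open import Level using (Level; 0ℓ)
open import Relation.Binary.Core using (Rel; _⇒_)
open import Relation.Binary.Definitions using (Decidable; Symmetric; tri<; tri≈; tri>)
open import Relation.Binary.Structures using (IsEquivalence; IsStrictTotalOrder)
import Relation.Binary.Construct.Flip.EqAndOrd as Flip
open import Relation.Binary.Construct.Intersection using (_∩_)
open import Relation.Binary.PropositionalEquality
  using (_≡_; _≢_; refl; sym; trans; cong; cong₂; subst; subst₂)
open import Relation.Nullary.Decidable
  using (Dec; yes; no; does; recompute; ¬?; _×-dec_; _→-dec_; dec⇒maybe; dec-true; dec-false; does-⇔)
open import Relation.Nullary.Negation using (¬_; contradiction-irr)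
import Relation.Unary as Unary

open import Defs
open Saturation using (Linked; linked?; xor-mid; xor-chain)

-- `Kr` is not its own inverse: applied twice it rotates the points. It is inverted here by
-- reversing the order, which turns the intervals (i, j] into [i, j). The two linkings form a Galois
-- connection, so one inclusion of the involution is formal. The other inclusion is the real work;
-- it is needed relative to a coarser partition and in both orientations, which is why the
-- underlying order is left arbitrary. The identity for Kr σ is a use of the reversed orientation: σ
-- is the reversed complement of Kr σ, hence σ ∧ Kr π is the reversed complement of Kr σ relative to
-- Kr π, and complementing once more returns Kr σ. The other obstacle is that both coproducts
-- multiply over blocks, whereas the bijection concerns partitions of the whole set. A family of
-- partitions, one in each block of τ, amounts to a single ρ ≤ τ, and the complement formed inside a
-- block agrees with the restriction of τ ∧ Kr ρ. One coproduct needs this for ρ ≤ Kr π, the other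
-- for π ≤ σ.

xor-transpose : ∀ a b c d → (a xor b) ≡ (c xor d) → (a xor c) ≡ (b xor d)
xor-transpose false false false false _ = refl
xor-transpose false false true  true  _ = refl
xor-transpose false true  false true  _ = refl
xor-transpose false true  true  false _ = refl
xor-transpose true  false false true  _ = refl
xor-transpose true  false true  false _ = refl
xor-transpose true  true  false false _ = refl
xor-transpose true  true  true  true  _ = refl

-- For the order < the relation Link is Linked, which defines Kr; for the
-- reversed order it defines the inverse of Kr.

module Links {n} {_≺_ : Rel (Fin n) 0ℓ}
             (isSTO : IsStrictTotalOrder _≡_ _≺_) (_≺?_ : Decidable _≺_) where

  private module ≺ = IsStrictTotalOrder isSTO

  before : Fin n → Fin n → Bool
  before i l = does (i ≺? l)

  Link : Rel (Fin n) 0ℓ → Rel (Fin n) 0ℓ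
  Link R i j = ∀ k l → R k l → (before i k xor before j k) ≡ (before i l xor before j l)

  Link-antitone : ∀ {R S} → R ⇒ S → Link S ⇒ Link R
  Link-antitone R⇒S ij k l = ij k l ∘ R⇒S

  Link-isEquivalence : ∀ R → IsEquivalence (Link R)
  Link-isEquivalence R = record
    { refl  = λ {i} k l _ → trans (Bool.xor-same (before i k)) (sym (Bool.xor-same (before i l)))
    ; sym   = λ {i j} p k l kl →
        trans (Bool.xor-comm (before j k) (before i k))
              (trans (p k l kl) (Bool.xor-comm (before i l) (before j l)))
    ; trans = λ {i j m} p q k l kl →
        trans (sym (xor-mid (before i k) (before j k) (before m k)))
              (trans (cong₂ _xor_ (p k l kl) (q k l kl))
                     (xor-mid (before i l) (before j l) (before m l))) }

  before-anti : ∀ {i j} l → i ≺ j → before i l ≡ false → before j l ≡ false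
  before-anti {i} {j} l i≺j p = dec-false (j ≺? l) λ j≺l →
    true≢false (trans (sym (dec-true (i ≺? l) (≺.trans i≺j j≺l))) p)
    where
    true≢false : ¬ true ≡ false
    true≢false ()

  -- The interval (a, b] is (a, c] minus (b, d], and a difference of two unions of classes is again
  -- one. On bits this is `xor-chain`, whose monotonicity hypotheses come from `before-anti`.
  Link-nonCrossing : ∀ R → NonCrossing _≺_ (Link R)
  Link-nonCrossing R {a} {b} {c} {d} a≺b b≺c c≺d ac bd k l kl =
    trans (chain k)
      (trans (cong₂ (λ x y → x ∧ not y) (ac k l kl) (bd k l kl)) (sym (chain l)))
    where
    chain : ∀ m → (before a m xor before b m)
                ≡ (before a m xor before c m) ∧ not (before b m xor before d m)
    chain m = xor-chain _ _ _ _ (before-anti m a≺b) (before-anti m b≺c) (before-anti m c≺d)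

  Between : Fin n → Fin n → Fin n → Set
  Between i j k = i ≺ k × ¬ (j ≺ k)

  between? : ∀ i j → Unary.Decidable (Between i j)
  between? i j k = (i ≺? k) ×-dec ¬? (j ≺? k)

  -- As j is not before i, the points after j are among those after i, so the symmetric difference
  -- occurring in `Link` is the half-open interval (i, j].
  between-xor : ∀ {i j} → ¬ (j ≺ i) → ∀ k →
                (before i k xor before j k) ≡ does (between? i j k)
  between-xor {i} {j} j⊀i k with i ≺? k | j ≺? k
  ... | yes _   | yes _   = refl
  ... | yes _   | no  _   = refl
  ... | no  _   | no  _   = refl
  ... | no  i⊀k | yes j≺k with ≺.compare i j
  ...   | tri< i≺j _ _    = ⊥-elim (i⊀k (≺.trans i≺j j≺k))
  ...   | tri≈ _ refl _   = ⊥-elim (i⊀k j≺k)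
  ...   | tri> _ _ j≺i    = ⊥-elim (j⊀i j≺i)

  link : ∀ {R i j} → Symmetric R → ¬ (j ≺ i) →
         (∀ {k l} → R k l → Between i j k → Between i j l) → Link R i j
  link {R} {i} {j} R-sym j⊀i closed k l kl =
    trans (between-xor j⊀i k)
      (trans (does-⇔ (mk⇔ (closed kl) (closed (R-sym kl))) (between? i j k) (between? i j l))
             (sym (between-xor j⊀i l)))

  link⁻ : ∀ {R i j} → ¬ (j ≺ i) → Link R i j →
          ∀ {k l} → R k l → Between i j k → Between i j l
  link⁻ {R} {i} {j} j⊀i ij {k} {l} kl k∈ = extract (between? i j l)
    (trans (sym (dec-true (between? i j k) k∈))
           (trans (sym (between-xor j⊀i k)) (trans (ij k l kl) (between-xor j⊀i l))))
    where
    extract : ∀ {P : Set} (P? : Dec P) → true ≡ does P? → P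
    extract (yes p) _ = p

-- Biduality of linking, relative to a coarser partition

module Involution {n} {_≺_ : Rel (Fin n) 0ℓ}
                  (isSTO : IsStrictTotalOrder _≡_ _≺_) (_≺?_ : Decidable _≺_) where

  private
    module ≺ = IsStrictTotalOrder isSTO
    module ≺L = Links isSTO _≺?_
    module ≻L = Links (Flip.isStrictTotalOrder isSTO) (flip _≺?_)

  -- Reversing the order exchanges the arguments of `before`. Hypothesis and goal are equations
  -- between the same four bits, paired by rows in one and by columns in the other.
  ⇒-bidual : ∀ R → R ⇒ ≻L.Link (≺L.Link R)
  ⇒-bidual R {i} {j} ij k l kl =
    xor-transpose (≺L.before k i) _ _ _ (kl i j ij)

  maximum : ∀ {P : Unary.Pred (Fin n) 0ℓ} → Unary.Decidable P → ∃ P →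
            Σ[ m ∈ Fin n ] P m × (∀ {x} → P x → ¬ (m ≺ x))
  maximum {P} P? (x , px) = go x px (spo-noetherian ≺.isStrictPartialOrder x)
    where
    go : ∀ x → P x → Acc (flip _≺_) x → Σ[ m ∈ Fin n ] P m × (∀ {y} → P y → ¬ (m ≺ y))
    go x px (acc rec) with Fin.any? (λ y → P? y ×-dec (x ≺? y))
    ... | yes (y , py , x≺y) = go y py (rec x≺y)
    ... | no  none           = x , px , λ {y} py x≺y → none (y , py , x≺y)

  connex : ∀ {x y} → ¬ (y ≺ x) → ¬ x ≡ y → x ≺ y
  connex {x} {y} y⊀x x≢y with ≺.compare x y
  ... | tri< x≺y _ _ = x≺y
  ... | tri≈ _ x≡y _ = ⊥-elim (x≢y x≡y)
  ... | tri> _ _ y≺x = ⊥-elim (y⊀x y≺x)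

  ⊀-≺ : ∀ {x y z} → ¬ (y ≺ x) → y ≺ z → x ≺ z
  ⊀-≺ {x} {y} y⊀x y≺z with ≺.compare x y
  ... | tri< x≺y _ _  = ≺.trans x≺y y≺z
  ... | tri≈ _ refl _ = y≺z
  ... | tri> _ _ y≺x  = ⊥-elim (y⊀x y≺x)

  ≺-⊀ : ∀ {x y z} → x ≺ y → ¬ (z ≺ y) → x ≺ z
  ≺-⊀ {x} {y} {z} x≺y z⊀y with ≺.compare y z
  ... | tri< y≺z _ _  = ≺.trans x≺y y≺z
  ... | tri≈ _ refl _ = x≺y
  ... | tri> _ _ z≺y  = ⊥-elim (z⊀y z≺y)

  module _ {R T : Rel (Fin n) 0ℓ} (R? : Decidable R) (T? : Decidable T)
           (R-eq : IsEquivalence R) (T-eq : IsEquivalence T)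
           (R-nc : NonCrossing _≺_ R) (T-nc : NonCrossing _≺_ T) (R⇒T : R ⇒ T) where

    private
      module R = IsEquivalence R-eq
      module T = IsEquivalence T-eq

    Preceding : Fin n → Fin n → Set
    Preceding j q = (T q j × q ≺ j) × (∀ {x} → T x j × x ≺ j → ¬ (q ≺ x))

    -- p and q are the cyclic predecessors of j in its R-block and in its
    -- T-block.

    link-after : ∀ {j p q} → Preceding j q → R p j → p ≺ j →
                 (∀ {x} → R x j × x ≺ j → ¬ (p ≺ x)) → ≺L.Link R p q
    link-after {j} {p} {q} ((qj , q≺j) , q-max) pj p≺j p-max =
      ≺L.link R.sym (q-max (R⇒T pj , p≺j)) closed
      where
      closed : ∀ {k l} → R k l → ≺L.Between p q k → ≺L.Between p q l
      closed {k} {l} kl (p≺k , q⊀k) = connex l⊀p p≢l , q⊀l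
        where
        k≺j : k ≺ j
        k≺j = ⊀-≺ q⊀k q≺j
        k≁j : ¬ R k j
        k≁j kj = p-max (kj , k≺j) p≺k
        p≢l : ¬ p ≡ l
        p≢l refl = k≁j (R.trans kl pj)
        l⊀p : ¬ l ≺ p
        l⊀p l≺p = k≁j (R.trans kl (R.trans (R-nc l≺p p≺k k≺j (R.sym kl) pj) pj))
        -- Beyond j, the class of k would cross the pair p, j in R. Between q and j, it would
        -- contain q or cross the pair p, q in T, and so put l into the T-block of j after q, its
        -- last point before j.
        q⊀l : ¬ q ≺ l
        q⊀l q≺l with ≺.compare l j
        ... | tri≈ _ refl _ = k≁j kl
        ... | tri> _ _ j≺l  =
          k≁j (R.trans (R.sym (R-nc p≺k k≺j j≺l pj kl)) pj)
        ... | tri< l≺j _ _  = l≁j (T.trans (T.sym (R⇒T kl))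
                (T.trans (T.sym (T-nc p≺k k≺q q≺l (T.trans (R⇒T pj) (T.sym qj)) (R⇒T kl))) (R⇒T pj)))
          where
          l≁j : ¬ T l j
          l≁j lj = q-max (lj , l≺j) q≺l
          k≺q : k ≺ q
          k≺q = connex q⊀k λ { refl → l≁j (T.trans (T.sym (R⇒T kl)) qj) }

    -- The case in which j is the first point of its R-class, so that its cyclic predecessor p is
    -- the last one. The interval is then (q, p] and contains the whole class of j. Any other class
    -- leaving it would cross that class in R or the pair q, j in T.
    link-wrap : ∀ {j p q} → Preceding j q → R p j → (∀ {x} → R x j → ¬ (x ≺ j)) →
                (∀ {x} → R x j → ¬ (p ≺ x)) → ≺L.Link R q p
    link-wrap {j} {p} {q} ((qj , q≺j) , q-max) pj j-min p-max =
      ≺L.link R.sym (λ p≺q → j-min pj (≺.trans p≺q q≺j)) closed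
      where
      p⊀j : ¬ p ≺ j
      p⊀j = j-min pj
      closed : ∀ {k l} → R k l → ≺L.Between q p k → ≺L.Between q p l
      closed {k} {l} kl (q≺k , p⊀k) with R? k j
      ... | yes kj = ≺-⊀ q≺j (j-min lj) , p-max lj
        where
        lj = R.trans (R.sym kl) kj
      ... | no k≁j with ≺.compare k j
      ...   | tri≈ _ refl _ = ⊥-elim (k≁j R.refl)
      ...   | tri< k≺j _ _ = connex l⊀q q≢l , p⊀l
        where
        k≁ᵀj : ¬ T k j
        k≁ᵀj kj = q-max (kj , k≺j) q≺k
        q≢l : ¬ q ≡ l
        q≢l refl = k≁ᵀj (T.trans (R⇒T kl) qj)
        l⊀q : ¬ l ≺ q
        l⊀q l≺q = k≁ᵀj (T.trans (R⇒T kl)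
                    (T.trans (T-nc l≺q q≺k k≺j (T.sym (R⇒T kl)) qj) qj))
        p⊀l : ¬ p ≺ l
        p⊀l p≺l = k≁ᵀj (T.trans (T.sym (T-nc q≺k k≺j (⊀-≺ p⊀j p≺l) qj (R⇒T kl))) qj)
      ...   | tri> _ _ j≺k = ≺-⊀ q≺j l⊀j , p⊀l
        where
        k≺p : k ≺ p
        k≺p = connex p⊀k λ { refl → k≁j pj }
        l⊀j : ¬ l ≺ j
        l⊀j l≺j = k≁j (R.trans kl (R-nc l≺j j≺k k≺p (R.sym kl) (R.sym pj)))
        p⊀l : ¬ p ≺ l
        p⊀l p≺l = k≁j (R.sym (R-nc j≺k k≺p p≺l (R.sym pj) kl))

    private
      Closed : Fin n → Fin n → Set
      Closed i j = ∀ {k l} → T k l → ≺L.Link R k l → ≻L.Between j i k → ≻L.Between j i l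

      -- If q ∈ [i, j) is the T-predecessor of j, closedness puts the cyclic
      -- R-predecessor p of j into [i, j) as well, and j is replaced by p.

      descend : ∀ {i j} → Acc _≺_ j → i ≺ j → T i j → Closed i j → R i j
      descend {i} {j} (acc rec) i≺j ij closed
        with maximum {λ x → T x j × x ≺ j} (λ x → T? x j ×-dec (x ≺? j)) (i , ij , i≺j)
           | Fin.any? (λ x → R? x j ×-dec (x ≺? j))
      ... | q , (qj , q≺j) , q-max | no none
        with p , pj , p-max ← maximum (λ x → R? x j) (j , R.refl)
        = ⊥-elim (none (p , pj , proj₁ (closed (T.trans qj (T.sym (R⇒T pj)))
            (link-wrap ((qj , q≺j) , q-max) pj (λ {x} xj x≺j → none (x , xj , x≺j)) p-max)
            (q≺j , q-max (ij , i≺j)))))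
      ... | q , (qj , q≺j) , q-max | yes below
        with p , (pj , p≺j) , p-max ← maximum {λ x → R x j × x ≺ j}
               (λ x → R? x j ×-dec (x ≺? j)) below
        with ≺.compare i p
           | closed (T.trans qj (T.sym (R⇒T pj)))
               (IsEquivalence.sym (≺L.Link-isEquivalence R) {p} {q}
                 (link-after ((qj , q≺j) , q-max) pj p≺j p-max))
               (q≺j , q-max (ij , i≺j))
      ...   | tri≈ _ refl _ | _ = pj
      ...   | tri> _ _ p≺i  | _ , p⊀i = ⊥-elim (p⊀i p≺i)
      ...   | tri< i≺p _ _  | _ =
        R.trans (descend (rec p≺j) i≺p (T.trans ij (T.sym (R⇒T pj))) closed′) pj
        where
        -- [i, p) is [i, j) minus [p, j), and [p, j) is closed under `≺L.Link R` by `⇒-bidual`, as p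
        -- and j are R-related.
        closed′ : Closed i p
        closed′ {k} {l} kl kl′ (k≺p , i⊀k)
          with closed kl kl′ (≺.trans k≺p p≺j , i⊀k) | l ≺? p
        ... | _   , i⊀l | yes l≺p = l≺p , i⊀l
        ... | l≺j , _   | no  l⊀p = ⊥-elim (proj₂ k∈ k≺p)
          where
          k∈ : ≻L.Between j p k
          k∈ = ≻L.link⁻ {≺L.Link R} (≺.asym p≺j) (⇒-bidual R (R.sym pj))
                 (IsEquivalence.sym (≺L.Link-isEquivalence R) {k} {l} kl′) (l≺j , l⊀p)

    -- Unlike `⇒-bidual`, this direction rests on finiteness and non-crossing. For i before j the
    -- hypothesis makes [i, j) closed under linking within T, and `descend` walks down from j
    -- through its R-class until it reaches i.
    relative-bidual : ∀ {i j} → T i j → ≻L.Link (T ∩ ≺L.Link R) i j → R i j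
    relative-bidual {i} {j} ij link with ≺.compare i j
    ... | tri≈ _ refl _ = R.refl
    ... | tri< i≺j _ _  = descend (spo-wellFounded ≺.isStrictPartialOrder j) i≺j ij
      λ kl kl′ → ≻L.link⁻ (≺.asym i≺j)
        (IsEquivalence.sym (≻L.Link-isEquivalence _) {i} {j} link) (kl , kl′)
    ... | tri> _ _ j≺i  = R.sym (descend (spo-wellFounded ≺.isStrictPartialOrder i) j≺i (T.sym ij)
      λ kl kl′ → ≻L.link⁻ (≺.asym j≺i) link (kl , kl′))

-- Kreweras complements

module <L {n} = Links (Fin.<-isStrictTotalOrder {n}) Fin._<?_
module >L {n} = Links (Flip.isStrictTotalOrder (Fin.<-isStrictTotalOrder {n})) (flip Fin._<?_)
module <I {n} = Involution (Fin.<-isStrictTotalOrder {n}) Fin._<?_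
module >I {n} = Involution (Flip.isStrictTotalOrder (Fin.<-isStrictTotalOrder {n})) (flip Fin._<?_)

𝟙-∼ : ∀ {n} .{{_ : NonZero n}} {i j : Fin n} → i ∼[ 𝟙 n ] j
𝟙-∼ = relVec⁺ (λ _ _ → yes tt) tt

≤ᴺ-elim : ∀ {n} {π σ : NC n} → π ≤ᴺ σ → ∀ {i j} → i ∼[ π ] j → i ∼[ σ ] j
≤ᴺ-elim {σ = σ} π≤σ {i} = π≤σ i i (∼.refl σ)

NC-ext : ∀ {n} {π σ : NC n} → (∀ {i j} → i ∼[ π ] j → i ∼[ σ ] j) →
         (∀ {i j} → i ∼[ σ ] j → i ∼[ π ] j) → π ≡ σ
NC-ext {π = π} {σ} f g = ≤ᴺ-antisym (≤ᴺ-intro π σ f) (≤ᴺ-intro σ π g)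

same? : ∀ {n} (π : NC n) → Decidable (SameBlock (blockVec π))
same? π i j = j ∈? blockOf π i

nonCrossing : ∀ {n} (π : NC n) → NonCrossing _<_ (SameBlock (blockVec π))
nonCrossing π = IsNC.nonCrossing (isNC π)

NonCrossing-flip : ∀ {n} {_≺_ R : Rel (Fin n) 0ℓ} → IsEquivalence R →
                   NonCrossing _≺_ R → NonCrossing (flip _≺_) R
NonCrossing-flip eq nc b≺a c≺b d≺c ac bd =
  R.trans ac (R.trans (R.sym (nc d≺c c≺b b≺a (R.sym bd) (R.sym ac))) (R.sym bd))
  where module R = IsEquivalence eq

module _ {n} (π σ : NC n) where

  private
    R? : Decidable (SameBlock (blockVec π) ∩ SameBlock (blockVec σ))
    R? i j = same? π i j ×-dec same? σ i j

  opaque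

    infixl 6 _⊓_
    _⊓_ : NC n
    _⊓_ = fromRelation R? {{nonZero π}}
      (record { refl  = ∼.refl π , ∼.refl σ
              ; sym   = λ (p , q) → ∼.sym π p , ∼.sym σ q
              ; trans = λ (p , q) (p′ , q′) → ∼.trans π p p′ , ∼.trans σ q q′ })
      (λ ab bc cd (p , q) (p′ , q′) → nonCrossing π ab bc cd p p′ , nonCrossing σ ab bc cd q q′)

    ⊓⁺ : ∀ {i j} → i ∼[ π ] j → i ∼[ σ ] j → i ∼[ _⊓_ ] j
    ⊓⁺ p q = relVec⁺ R? (p , q)

    ⊓⁻ : ∀ {i j} → i ∼[ _⊓_ ] j → i ∼[ π ] j × i ∼[ σ ] j
    ⊓⁻ = relVec⁻ R?

  ⊓-≤ˡ : _⊓_ ≤ᴺ π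
  ⊓-≤ˡ = ≤ᴺ-intro _⊓_ π (proj₁ ∘ ⊓⁻)

  ⊓-≤ʳ : _⊓_ ≤ᴺ σ
  ⊓-≤ʳ = ≤ᴺ-intro _⊓_ σ (proj₂ ∘ ⊓⁻)

opaque
  unfolding Kr

  Kr⁺ : ∀ {n} (π : NC n) {i j} → Linked π i j → i ∼[ Kr π ] j
  Kr⁺ π = relVec⁺ (linked? π)

  Kr⁻ : ∀ {n} (π : NC n) {i j} → i ∼[ Kr π ] j → Linked π i j
  Kr⁻ π = relVec⁻ (linked? π)

module _ {n} (π : NC n) where

  private
    R? : Decidable (>L.Link (SameBlock (blockVec π)))
    R? i j = Fin.all? λ k → Fin.all? λ l → same? π k l →-dec
      ((>L.before i k xor >L.before j k) Bool.≟ (>L.before i l xor >L.before j l))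

  opaque

    Kr⁻¹ : NC n
    Kr⁻¹ = fromRelation R? {{nonZero π}} (>L.Link-isEquivalence _)
      (λ {a} {b} {c} {d} → NonCrossing-flip (>L.Link-isEquivalence _)
        (λ {a} {b} {c} {d} → >L.Link-nonCrossing _ {a} {b} {c} {d}) {a} {b} {c} {d})

    Kr⁻¹⁺ : ∀ {i j} → >L.Link (SameBlock (blockVec π)) i j → i ∼[ Kr⁻¹ ] j
    Kr⁻¹⁺ = relVec⁺ R?

    Kr⁻¹⁻ : ∀ {i j} → i ∼[ Kr⁻¹ ] j → >L.Link (SameBlock (blockVec π)) i j
    Kr⁻¹⁻ = relVec⁻ R?

Kr-antitone : ∀ {n} {π σ : NC n} → π ≤ᴺ σ → Kr σ ≤ᴺ Kr π
Kr-antitone {π = π} {σ} π≤σ = ≤ᴺ-intro (Kr σ) (Kr π) λ {i} {j} p →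
  Kr⁺ π (<L.Link-antitone (≤ᴺ-elim {π = π} {σ} π≤σ) {i} {j} (Kr⁻ σ p))

-- τ ⊓ Kr ρ is the complement of ρ relative to τ, block by block.

module _ {n} {ρ τ : NC n} (ρ≤τ : ρ ≤ᴺ τ) where

  bidual-≤ : ∀ {i j} → i ∼[ τ ] j → >L.Link (SameBlock (blockVec (τ ⊓ Kr ρ))) i j → i ∼[ ρ ] j
  bidual-≤ {i} {j} ij p = <I.relative-bidual (same? ρ) (same? τ)
    (IsNC.isEquivalence (isNC ρ)) (IsNC.isEquivalence (isNC τ))
    (nonCrossing ρ) (nonCrossing τ) (≤ᴺ-elim {π = ρ} {τ} ρ≤τ) ij
    (>L.Link-antitone (λ (q , r) → ⊓⁺ τ (Kr ρ) q (Kr⁺ ρ r)) {i} {j} p)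

  bidual-≥ : ∀ {i j} → i ∼[ τ ] j →
             <L.Link (SameBlock (blockVec τ) ∩ >L.Link (SameBlock (blockVec ρ))) i j → i ∼[ ρ ] j
  bidual-≥ = >I.relative-bidual (same? ρ) (same? τ)
    (IsNC.isEquivalence (isNC ρ)) (IsNC.isEquivalence (isNC τ))
    (NonCrossing-flip (IsNC.isEquivalence (isNC ρ)) (nonCrossing ρ))
    (NonCrossing-flip (IsNC.isEquivalence (isNC τ)) (nonCrossing τ)) (≤ᴺ-elim {π = ρ} {τ} ρ≤τ)

-- The relative statement for τ = `𝟙 n`, where lying in a common τ-block is automatic.
Kr-bidual : ∀ {n} (π : NC n) {i j} → >L.Link (SameBlock (blockVec (Kr π))) i j → i ∼[ π ] j
Kr-bidual {n} π {i} {j} p = bidual-≤ {ρ = π} {𝟙 n} (≤ᴺ-𝟙 π) 𝟙-∼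
  (>L.Link-antitone (proj₂ ∘ ⊓⁻ (𝟙 n) (Kr π)) {i} {j} p)
  where instance
    n≢0 : NonZero n
    n≢0 = nonZero π

Kr-injective : ∀ {n} {π σ : NC n} → Kr π ≡ Kr σ → π ≡ σ
Kr-injective {π = π} {σ} eq = NC-ext (half {π} {σ} eq) (half {σ} {π} (sym eq))
  where
  half : ∀ {π σ} → Kr π ≡ Kr σ → ∀ {i j} → i ∼[ π ] j → i ∼[ σ ] j
  half {π} {σ} eq {i} {j} ij = Kr-bidual σ
    (>L.Link-antitone (λ {k} {l} p → Kr⁻ π (subst (k ∼[_] l) (sym eq) p)) {i} {j}
      (<I.⇒-bidual _ ij))

Kr-𝟘 : ∀ {n} .{{_ : NonZero n}} → Kr (𝟘 n) ≡ 𝟙 n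
Kr-𝟘 {n} = NC-ext (λ _ → 𝟙-∼)
  (λ {i} {j} _ → Kr⁺ (𝟘 n) {i} {j} λ k l p →
    cong (λ m → <L.before i m xor <L.before j m) (relVec⁻ Fin._≟_ {k} {l} p))

-- One inclusion is antitonicity, for π ≤ σ and for σ ⊓ Kr π ≤ σ. For the other, `Kr-bidual` puts
-- the reversed complement of Kr σ inside σ, hence its part relative to Kr π inside σ ⊓ Kr π, and
-- the reversed biduality for Kr σ ≤ Kr π applies.
Kr-≥ : ∀ {n} (π σ : NC n) → π ≤ᴺ σ → Kr σ ≡ Kr π ⊓ Kr (σ ⊓ Kr π)
Kr-≥ π σ π≤σ = NC-ext
  (λ {i} {j} p → ⊓⁺ τ (Kr ρ) (≤ᴺ-elim {π = Kr σ} {Kr π} (Kr-antitone {π = π} {σ} π≤σ) p)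
     (≤ᴺ-elim {π = Kr σ} {Kr ρ} (Kr-antitone {π = ρ} {σ} (⊓-≤ˡ σ τ)) p))
  (λ {i} {j} p → bidual-≥ {ρ = Kr σ} {τ} (Kr-antitone {π = π} {σ} π≤σ) (proj₁ (⊓⁻ τ (Kr ρ) p))
     (<L.Link-antitone (λ (kl , kl′) → ⊓⁺ σ τ (Kr-bidual σ kl′) kl) {i} {j}
       (Kr⁻ ρ (proj₂ (⊓⁻ τ (Kr ρ) p)))))
  where
  τ = Kr π
  ρ = σ ⊓ τ

⊓-Kr-injective : ∀ {n} (π : NC n) {σ σ′} → π ≤ᴺ σ → π ≤ᴺ σ′ → σ ⊓ Kr π ≡ σ′ ⊓ Kr π → σ ≡ σ′
⊓-Kr-injective π {σ} {σ′} π≤σ π≤σ′ eq = Kr-injective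
  (trans (Kr-≥ π σ π≤σ) (trans (cong (λ ρ → Kr π ⊓ Kr ρ) eq) (sym (Kr-≥ π σ′ π≤σ′))))

⊓-Kr-surjective : ∀ {n} (π : NC n) {ρ} → ρ ≤ᴺ Kr π → Σ[ σ ∈ NC n ] π ≤ᴺ σ × ρ ≡ σ ⊓ Kr π
⊓-Kr-surjective π {ρ} ρ≤τ = σ , π≤σ , NC-ext
  (λ {i} {j} ij → ⊓⁺ σ τ
    (Kr⁻¹⁺ η {i} {j} (>L.Link-antitone (Kr⁻ ρ ∘ proj₂ ∘ ⊓⁻ τ (Kr ρ)) {i} {j} (<I.⇒-bidual _ ij)))
    (≤ᴺ-elim {π = ρ} {τ} ρ≤τ ij))
  (λ ij → let ijσ , ijτ = ⊓⁻ σ τ ij in bidual-≤ {ρ = ρ} {τ} ρ≤τ ijτ (Kr⁻¹⁻ η ijσ))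
  where
  τ = Kr π
  η = τ ⊓ Kr ρ
  -- Forced by `Kr-≥`: if ρ = σ ⊓ Kr π, then Kr σ must be Kr π ⊓ Kr ρ, which is η.
  σ = Kr⁻¹ η
  π≤σ : π ≤ᴺ σ
  π≤σ = ≤ᴺ-intro π σ λ {i} {j} ij → Kr⁻¹⁺ η {i} {j}
    (>L.Link-antitone (Kr⁻ π ∘ proj₁ ∘ ⊓⁻ τ (Kr ρ)) {i} {j} (<I.⇒-bidual _ ij))

-- Restriction to the blocks of a coarser partition

module _ {n} (W : Subset n) where

  element-cancel-< : ∀ {i j} → element W i < element W j → i < j
  element-cancel-< {i} {j} p with Fin.<-cmp i j
  ... | tri< i<j _ _  = i<j
  ... | tri≈ _ refl _ = ⊥-elim (ℕ.<-irrefl refl p)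
  ... | tri> _ _ j<i  = ⊥-elim (ℕ.<-asym p (element-mono W j<i))

  before-element : ∀ i k → <L.before (element W i) (element W k) ≡ <L.before i k
  before-element i k = does-⇔ (mk⇔ element-cancel-< (element-mono W)) (_ Fin.<? _) (_ Fin.<? _)

element-injective : ∀ {n} (W : Subset n) {i j} → element W i ≡ element W j → i ≡ j
element-injective (outside ∷ W)                 eq = element-injective W (Fin.suc-injective eq)
element-injective (inside  ∷ W) {zero}  {zero}  eq = refl
element-injective (inside  ∷ W) {suc i} {suc j} eq =
  cong suc (element-injective W (Fin.suc-injective eq))

element-∈ : ∀ {n} (W : Subset n) i → element W i Subset.∈ W
element-∈ (outside ∷ W) i       = there (element-∈ W i)
element-∈ (inside  ∷ W) zero    = here
element-∈ (inside  ∷ W) (suc i) = there (element-∈ W i)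

element-onto : ∀ {n} (W : Subset n) {x} → x Subset.∈ W → ∃ λ i → element W i ≡ x
element-onto (outside ∷ W) (there p) with i , refl ← element-onto W p = i , refl
element-onto (inside  ∷ W) here      = zero , refl
element-onto (inside  ∷ W) (there p) with i , refl ← element-onto W p = suc i , refl

module _ {n} (π : NC n) (W : NonemptySubset n) where

  restrict⁺ : ∀ {i j} → element (subset W) i ∼[ π ] element (subset W) j → i ∼[ restrict π W ] j
  restrict⁺ {i} {j} = relVec⁺ (λ i j → element (subset W) j ∈? blockOf π (element (subset W) i)) {i} {j}

  restrict⁻ : ∀ {i j} → i ∼[ restrict π W ] j → element (subset W) i ∼[ π ] element (subset W) j
  restrict⁻ {i} {j} = relVec⁻ (λ i j → element (subset W) j ∈? blockOf π (element (subset W) i)) {i} {j}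

module _ {n} (τ : NC n) where

  blockAt : Fin n → NonemptySubset n
  blockAt i = mkNonempty (blockOf τ i) (i , ∼.refl τ)

  blockAt-∈ : ∀ i → blockAt i ∈ blocks τ
  blockAt-∈ i = List.∈-deduplicate⁺ _ (List.∈-tabulate⁺ i)

  ∈-blocks⁻ : ∀ {W} → W ∈ blocks τ → ∃ λ i → W ≡ blockAt i
  ∈-blocks⁻ p = List.∈-tabulate⁻ (List.∈-deduplicate⁻ _ _ p)

  block-∼ : ∀ {W} → W ∈ blocks τ → ∀ {x y} → x Subset.∈ subset W → y Subset.∈ subset W → x ∼[ τ ] y
  block-∼ W∈ p q with i , refl ← ∈-blocks⁻ W∈ = ∼.trans τ (∼.sym τ p) q

  block-closed : ∀ {W} → W ∈ blocks τ → ∀ {x y} → x Subset.∈ subset W → x ∼[ τ ] y → y Subset.∈ subset W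
  block-closed W∈ p q with i , refl ← ∈-blocks⁻ W∈ = ∼.trans τ p q

  private
    Avoiding : Fin n → Rel (Fin n) 0ℓ
    Avoiding i k l = k ∼[ τ ] l × ¬ k ∼[ τ ] i

    ordered : ∀ {i j} → i < j → i ∼[ τ ] j → <L.Link (Avoiding i) i j
    ordered {i} {j} i<j ij = <L.link {R = Avoiding i} {i = i} {j}
      (λ (kl , k≁i) → ∼.sym τ kl , λ li → k≁i (∼.trans τ kl li)) (ℕ.<-asym i<j)
      λ {k} {l} (kl , k≁i) (i<k , j≮k) →
        let k<j = Fin.≤∧≢⇒< (ℕ.≮⇒≥ j≮k) λ { refl → k≁i (∼.sym τ ij) } in
        Fin.≤∧≢⇒< (ℕ.≮⇒≥ λ l<i → k≁i (∼.trans τ kl (nonCrossing τ l<i i<k k<j (∼.sym τ kl) ij)))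
                  (λ { refl → k≁i kl }) ,
        λ j<l → k≁i (∼.sym τ (nonCrossing τ i<k k<j j<l ij kl))

  -- A block of τ other than that of i and j cannot have points both inside and outside (i, j]
  -- without crossing it. In `Kr-restrict` this disposes of all pairs lying outside the chosen
  -- block.
  linked-outside : ∀ {i j} → i ∼[ τ ] j → <L.Link (λ k l → k ∼[ τ ] l × ¬ k ∼[ τ ] i) i j
  linked-outside {i} {j} ij with Fin.<-cmp i j
  ... | tri< i<j _ _  = ordered i<j ij
  ... | tri≈ _ refl _ = IsEquivalence.refl (<L.Link-isEquivalence (Avoiding i)) {i}
  ... | tri> _ _ j<i  = IsEquivalence.sym (<L.Link-isEquivalence (Avoiding i)) {j} {i}
    (<L.Link-antitone (λ (kl , k≁i) → kl , λ kj → k≁i (∼.trans τ kj (∼.sym τ ij))) {j} {i}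
      (ordered j<i (∼.sym τ ij)))

-- Since ρ ≤ τ, a ρ-related pair lies wholly inside or wholly outside W. Inside, `element` preserves
-- and reflects the order, so the linking conditions coincide; outside, `linked-outside` makes the
-- condition hold for any two points of W.
Kr-restrict : ∀ {n} {ρ τ : NC n} → ρ ≤ᴺ τ → ∀ {W} → W ∈ blocks τ →
              Kr (restrict ρ W) ≡ restrict (τ ⊓ Kr ρ) W
Kr-restrict {ρ = ρ} {τ} ρ≤τ {W@(mkNonempty S _)} W∈ = NC-ext
  (λ {i} {j} p → restrict⁺ (τ ⊓ Kr ρ) W {i} {j}
    (⊓⁺ τ (Kr ρ) (e∼ i j) (Kr⁺ ρ (extend (Kr⁻ (restrict ρ W) p)))))
  (λ {i} {j} p → Kr⁺ (restrict ρ W) {i} {j} λ k l kl →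
    trans (sym (xor-element i j k))
      (trans (Kr⁻ ρ (proj₂ (⊓⁻ τ (Kr ρ) (restrict⁻ (τ ⊓ Kr ρ) W {i} {j} p))) _ _ (restrict⁻ ρ W {k} {l} kl))
             (xor-element i j l)))
  where
  e = element S

  e∼ : ∀ i j → e i ∼[ τ ] e j
  e∼ i j = block-∼ τ W∈ (element-∈ S i) (element-∈ S j)

  xor-element : ∀ i j k → (<L.before (e i) (e k) xor <L.before (e j) (e k))
                        ≡ (<L.before i k xor <L.before j k)
  xor-element i j k = cong₂ _xor_ (before-element S i k) (before-element S j k)

  extend : ∀ {i j} → Linked (restrict ρ W) i j → Linked ρ (e i) (e j)
  extend {i} {j} p k l kl with k ∈? S
  ... | no  k∉S = linked-outside τ (e∼ i j) k l
    (≤ᴺ-elim {π = ρ} {τ} ρ≤τ kl , λ ki → k∉S (block-closed τ W∈ (element-∈ S i) (∼.sym τ ki)))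
  ... | yes k∈S
    with k′ , refl ← element-onto S k∈S
       | l′ , refl ← element-onto S (block-closed τ W∈ k∈S (≤ᴺ-elim {π = ρ} {τ} ρ≤τ kl))
    = trans (xor-element i j k′)
        (trans (p k′ l′ (restrict⁺ ρ W {k′} {l′} kl)) (sym (xor-element i j l′)))

-- Sums and products over partitions and blocks

private variable
  a b : Level
  A : Set a
  B : Set b

-- The later injectivity and disjointness arguments hold only for members of the list, so R is
-- required only there.
AllPairs-unique : ∀ {r} {R : Rel A r} {xs : List A} →
                  (∀ {x y} → x ∈ xs → y ∈ xs → x ≢ y → R x y) → Unique xs → AllPairs R xs
AllPairs-unique r []       = []
AllPairs-unique r (p ∷ ps) =
  All.tabulate (λ y∈ → r (here refl) (there y∈) (All.lookup p y∈)) ∷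
  AllPairs-unique (λ x∈ y∈ → r (there x∈) (there y∈)) ps

Unique-map : (f : A → B) {xs : List A} →
             (∀ {x y} → x ∈ xs → y ∈ xs → f x ≡ f y → x ≡ y) → Unique xs → Unique (map f xs)
Unique-map f inj u = AllPairs.map⁺ (AllPairs-unique (λ x∈ y∈ x≢y → x≢y ∘ inj x∈ y∈) u)

module _ (f : A → Maybe B) where

  ∈-mapMaybe⁺ : ∀ {xs x y} → x ∈ xs → f x ≡ just y → y ∈ mapMaybe f xs
  ∈-mapMaybe⁺ {x ∷ xs} (here refl) eq with f x
  ∈-mapMaybe⁺ {x ∷ xs} (here refl) refl | just _ = here refl
  ∈-mapMaybe⁺ {x ∷ xs} (there x∈)  eq with f x
  ... | just _  = there (∈-mapMaybe⁺ x∈ eq)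
  ... | nothing = ∈-mapMaybe⁺ x∈ eq

  ∈-mapMaybe⁻ : ∀ {xs y} → y ∈ mapMaybe f xs → ∃ λ x → x ∈ xs × f x ≡ just y
  ∈-mapMaybe⁻ {x ∷ xs} y∈ with f x in eq
  ∈-mapMaybe⁻ {x ∷ xs} (here refl) | just _ = x , here refl , eq
  ∈-mapMaybe⁻ {x ∷ xs} (there y∈)  | just _  with x′ , x′∈ , p ← ∈-mapMaybe⁻ y∈ = x′ , there x′∈ , p
  ∈-mapMaybe⁻ {x ∷ xs} y∈          | nothing with x′ , x′∈ , p ← ∈-mapMaybe⁻ y∈ = x′ , there x′∈ , p

  Unique-mapMaybe : (∀ {x x′ y} → f x ≡ just y → f x′ ≡ just y → x ≡ x′) →
                    ∀ {xs} → Unique xs → Unique (mapMaybe f xs)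
  Unique-mapMaybe inj {[]}     []       = []
  Unique-mapMaybe inj {x ∷ xs} (p ∷ ps) with f x in eq
  ... | nothing = Unique-mapMaybe inj ps
  ... | just y  = All.tabulate fresh ∷ Unique-mapMaybe inj ps
    where
    fresh : ∀ {z} → z ∈ mapMaybe f xs → y ≢ z
    fresh z∈ refl with x′ , x′∈ , eq′ ← ∈-mapMaybe⁻ z∈ = All.lookup p x′∈ (inj eq eq′)

Unique-vectors : {xs : List A} → Unique xs → ∀ n → Unique (vectors xs n)
Unique-vectors u zero    = [] ∷ []
Unique-vectors u (suc n) = Unique.cartesianProductWith⁺ _∷_ ∷-injective u (Unique-vectors u n)

∈-vectors : {xs : List A} → (∀ x → x ∈ xs) → ∀ {n} (v : Vec A n) → v ∈ vectors xs n
∈-vectors all []      = here refl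
∈-vectors all (x ∷ v) = List.∈-cartesianProductWith⁺ _∷_ (all x) (∈-vectors all v)

module _ {n : ℕ} where

  private
    toNC : Vec (Subset n) n → Maybe (NC n)
    toNC M = Maybe.map (λ p → mkNC M p) (dec⇒maybe (isNC? M))

    toNC⁻ : ∀ M {π} → toNC M ≡ just π → M ≡ blockVec π
    toNC⁻ M eq with isNC? M
    toNC⁻ M refl | yes _ = refl

    toNC-complete : ∀ π → toNC (blockVec π) ≡ just π
    toNC-complete π with isNC? (blockVec π)
    ... | yes _ = refl
    ... | no ¬p = ⊥-elim (¬p (isNC π))

  Unique-allNC : Unique (allNC n)
  Unique-allNC = Unique-mapMaybe toNC
    (λ {M} {N} p q → trans (toNC⁻ M p) (sym (toNC⁻ N q)))
    (Unique-vectors (Unique-vectors (((λ ()) ∷ []) ∷ [] ∷ []) n) n)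

  ∈-allNC : (π : NC n) → π ∈ allNC n
  ∈-allNC π = ∈-mapMaybe⁺ toNC
    (∈-vectors (∈-vectors λ { true → here refl ; false → there (here refl) }) (blockVec π))
    (toNC-complete π)

-- Set over a commutative monoid so that the same reindexing serves sums over partitions and
-- products over blocks.
module BigOperator {c ℓ} (M : CommutativeMonoid c ℓ) where

  private module ≈ = CommutativeMonoid M
  open CommutativeMonoid M hiding (refl; sym; trans)
  open import Algebra.Properties.CommutativeSemigroup commutativeSemigroup
    using (interchange; x∙yz≈y∙xz)

  ⨁ : List A → (A → Carrier) → Carrier
  ⨁ xs f = foldr (λ x s → f x ∙ s) ε xs

  ⨁-cong : ∀ (xs : List A) {f g : A → Carrier} → (∀ {x} → x ∈ xs → f x ≈ g x) → ⨁ xs f ≈ ⨁ xs g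
  ⨁-cong []       f≈g = ≈.refl
  ⨁-cong (x ∷ xs) f≈g = ∙-cong (f≈g (here refl)) (⨁-cong xs (f≈g ∘ there))

  ⨁-∙ : ∀ (xs : List A) (f g : A → Carrier) → ⨁ xs (λ x → f x ∙ g x) ≈ ⨁ xs f ∙ ⨁ xs g
  ⨁-∙ []       f g = ≈.sym (identityˡ ε)
  ⨁-∙ (x ∷ xs) f g = ≈.trans (∙-congˡ (⨁-∙ xs f g)) (interchange _ _ _ _)

  ⨁-map : ∀ (h : A → B) (xs : List A) (f : B → Carrier) → ⨁ (map h xs) f ≈ ⨁ xs (f ∘ h)
  ⨁-map h []       f = ≈.refl
  ⨁-map h (x ∷ xs) f = ∙-congˡ (⨁-map h xs f)

  ⨁-++ : ∀ (xs ys : List A) (f : A → Carrier) → ⨁ (xs ++ ys) f ≈ ⨁ xs f ∙ ⨁ ys f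
  ⨁-++ []       ys f = ≈.sym (identityˡ _)
  ⨁-++ (x ∷ xs) ys f = ≈.trans (∙-congˡ (⨁-++ xs ys f))
    (≈.sym (assoc _ _ _))

  ⨁-concatMap : ∀ (h : A → List B) (xs : List A) (f : B → Carrier) →
                ⨁ (concatMap h xs) f ≈ ⨁ xs (λ x → ⨁ (h x) f)
  ⨁-concatMap h []       f = ≈.refl
  ⨁-concatMap h (x ∷ xs) f = ≈.trans (⨁-++ (h x) _ f) (∙-congˡ (⨁-concatMap h xs f))

  ⨁-↭ : ∀ {xs ys : List A} (f : A → Carrier) → xs ↭ ys → ⨁ xs f ≈ ⨁ ys f
  ⨁-↭ f ↭-refl         = ≈.refl
  ⨁-↭ f (prep x p)     = ∙-congˡ (⨁-↭ f p)
  ⨁-↭ f (swap x y p)   =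
    ≈.trans (∙-congˡ (∙-congˡ (⨁-↭ f p))) (x∙yz≈y∙xz _ _ _)
  ⨁-↭ f (↭-trans p q)  = ≈.trans (⨁-↭ f p) (⨁-↭ f q)

  ⨁-unique : ∀ {xs ys : List A} (f : A → Carrier) → Unique xs → Unique ys →
             (∀ {x} → x ∈ xs → x ∈ ys) → (∀ {x} → x ∈ ys → x ∈ xs) → ⨁ xs f ≈ ⨁ ys f
  ⨁-unique f u v p q = ⨁-↭ f (∼bag⇒↭ (unique∧set⇒bag u v (mk⇔ p q)))

  ⨁-reindex : ∀ {xs : List A} {ys : List B} (h : A → B) (f : B → Carrier) →
              Unique xs → Unique ys →
              (∀ {x} → x ∈ xs → h x ∈ ys) →
              (∀ {x y} → x ∈ xs → y ∈ xs → h x ≡ h y → x ≡ y) →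
              (∀ {y} → y ∈ ys → ∃ λ x → x ∈ xs × y ≡ h x) →
              ⨁ ys f ≈ ⨁ xs (f ∘ h)
  ⨁-reindex {xs = xs} {ys} h f u v into inj onto = ≈.trans
    (⨁-unique f v (Unique-map h inj u) to from) (⨁-map h xs f)
    where
    to : ∀ {y} → y ∈ ys → y ∈ map h xs
    to y∈ with x , x∈ , refl ← onto y∈ = List.∈-map⁺ h x∈
    from : ∀ {y} → y ∈ map h xs → y ∈ ys
    from y∈ with x , x∈ , refl ← List.∈-map⁻ h y∈ = into x∈

-- Blocks of a refinement, sorted by the blocks of the coarser partition

NonemptySubset-≡ : ∀ {n} {V W : NonemptySubset n} → subset V ≡ subset W → V ≡ W
NonemptySubset-≡ refl = refl

module _ {n} (τ : NC n) where

  Unique-blocks : Unique (blocks τ)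
  Unique-blocks = DecUnique.deduplicate-! _ _

  block-unique : ∀ {V W} → V ∈ blocks τ → W ∈ blocks τ →
                 ∀ {x} → x Subset.∈ subset V → x Subset.∈ subset W → V ≡ W
  block-unique V∈ W∈ x∈V x∈W = NonemptySubset-≡ (⊆-antisym
    (λ y∈V → block-closed τ W∈ x∈W (block-∼ τ V∈ x∈V y∈V))
    (λ y∈W → block-closed τ V∈ x∈V (block-∼ τ W∈ x∈W y∈W)))

embedSubset : ∀ {n} (W : Subset n) → Subset ∣ W ∣ → Subset n
embedSubset []            V       = []
embedSubset (outside ∷ W) V       = outside ∷ embedSubset W V
embedSubset (inside  ∷ W) (v ∷ V) = v ∷ embedSubset W V

∣embedSubset∣ : ∀ {n} (W : Subset n) V → ∣ embedSubset W V ∣ ≡ ∣ V ∣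
∣embedSubset∣ []            []            = refl
∣embedSubset∣ (outside ∷ W) V             = ∣embedSubset∣ W V
∣embedSubset∣ (inside  ∷ W) (outside ∷ V) = ∣embedSubset∣ W V
∣embedSubset∣ (inside  ∷ W) (inside  ∷ V) = cong suc (∣embedSubset∣ W V)

embedSubset-injective : ∀ {n} (W : Subset n) {U V} → embedSubset W U ≡ embedSubset W V → U ≡ V
embedSubset-injective []            {[]}    {[]}    _  = refl
embedSubset-injective (outside ∷ W) eq = embedSubset-injective W (proj₂ (∷-injective eq))
embedSubset-injective (inside  ∷ W) {_ ∷ _} {_ ∷ _} eq with refl , eq′ ← ∷-injective eq =
  cong (_ ∷_) (embedSubset-injective W eq′)

∈-embedSubset⁺ : ∀ {n} (W : Subset n) {V i} → i Subset.∈ V → element W i Subset.∈ embedSubset W V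
∈-embedSubset⁺ (outside ∷ W)     p              = there (∈-embedSubset⁺ W p)
∈-embedSubset⁺ (inside  ∷ W) {_ ∷ V} here      = here
∈-embedSubset⁺ (inside  ∷ W) {_ ∷ V} (there p) = there (∈-embedSubset⁺ W p)

∈-embedSubset⁻ : ∀ {n} (W : Subset n) {V x} → x Subset.∈ embedSubset W V →
                 ∃ λ i → i Subset.∈ V × element W i ≡ x
∈-embedSubset⁻ (outside ∷ W) {V} (there p) with i , i∈ , refl ← ∈-embedSubset⁻ W p = i , i∈ , refl
∈-embedSubset⁻ (inside  ∷ W) {_ ∷ V} here = zero , here , refl
∈-embedSubset⁻ (inside  ∷ W) {_ ∷ V} (there p) with i , i∈ , refl ← ∈-embedSubset⁻ W p =
  suc i , there i∈ , refl

embed : ∀ {n} (W : NonemptySubset n) → NonemptySubset (size W) → NonemptySubset n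
embed (mkNonempty W _) (mkNonempty V V≠∅) =
  mkNonempty (embedSubset W V) (element W (proj₁ V≠∅) , ∈-embedSubset⁺ W (proj₂ V≠∅))

embed-injective : ∀ {n} (W : NonemptySubset n) {U V} → embed W U ≡ embed W V → U ≡ V
embed-injective W eq = NonemptySubset-≡ (embedSubset-injective (subset W) (cong subset eq))

module _ {n} {ρ τ : NC n} (ρ≤τ : ρ ≤ᴺ τ) where

  private
    ρ⇒τ : ∀ {x y} → x ∼[ ρ ] y → x ∼[ τ ] y
    ρ⇒τ = ≤ᴺ-elim {π = ρ} {τ} ρ≤τ

    blocksIn : NonemptySubset n → List (NonemptySubset n)
    blocksIn W = map (embed W) (blocks (restrict ρ W))

  -- The ρ-block of a point of W stays inside W because ρ ≤ τ, so the restriction to W loses none of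
  -- it.
  embed-blockAt : ∀ {W} → W ∈ blocks τ → ∀ i →
                  embed W (blockAt (restrict ρ W) i) ≡ blockAt ρ (element (subset W) i)
  embed-blockAt {W} W∈ i = NonemptySubset-≡ (⊆-antisym to from)
    where
    S = subset W
    to : ∀ {x} → x Subset.∈ embedSubset S (blockOf (restrict ρ W) i) → element S i ∼[ ρ ] x
    to p with j , ij , refl ← ∈-embedSubset⁻ S p = restrict⁻ ρ W {i} {j} ij
    from : ∀ {x} → element S i ∼[ ρ ] x → x Subset.∈ embedSubset S (blockOf (restrict ρ W) i)
    from p with j , refl ← element-onto S (block-closed τ W∈ (element-∈ S i) (ρ⇒τ p)) =
      ∈-embedSubset⁺ S (restrict⁺ ρ W {i} {j} p)

  private
    blocksIn⁻ : ∀ {V W} → W ∈ blocks τ → V ∈ blocksIn W →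
                ∃ λ i → V ≡ blockAt ρ (element (subset W) i)
    blocksIn⁻ {V} {W} W∈ V∈ = go (List.∈-map⁻ (embed W) V∈)
      where
      at : ∀ {U} → V ≡ embed W U → (∃ λ i → U ≡ blockAt (restrict ρ W) i) →
           ∃ λ i → V ≡ blockAt ρ (element (subset W) i)
      at eq (i , refl) = i , trans eq (embed-blockAt W∈ i)
      go : (∃ λ U → U ∈ blocks (restrict ρ W) × V ≡ embed W U) →
           ∃ λ i → V ≡ blockAt ρ (element (subset W) i)
      go (U , U∈ , eq) = at eq (∈-blocks⁻ (restrict ρ W) U∈)

    Unique-concat : Unique (concatMap blocksIn (blocks τ))
    Unique-concat = Unique.concat⁺
      (All.map⁺ (All.tabulate λ {W} _ → Unique.map⁺ (embed-injective W) (Unique-blocks (restrict ρ W))))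
      (AllPairs.map⁺ (AllPairs-unique disjoint (Unique-blocks τ)))
      where
      disjoint : ∀ {V W} → V ∈ blocks τ → W ∈ blocks τ → V ≢ W → Disjoint (blocksIn V) (blocksIn W)
      disjoint {V} {W} V∈ W∈ V≢W {U} (U∈V , U∈W) =
        go (blocksIn⁻ {W = V} V∈ U∈V) (blocksIn⁻ {W = W} W∈ U∈W)
        where
        go : (∃ λ i → U ≡ blockAt ρ (element (subset V) i)) →
             (∃ λ j → U ≡ blockAt ρ (element (subset W) j)) → ⊥
        go (i , p) (j , q) = V≢W (block-unique τ V∈ W∈ (element-∈ (subset V) i)
          (block-closed τ W∈ (element-∈ (subset W) j)
            (ρ⇒τ (subst (element (subset V) i Subset.∈_) (cong subset (trans (sym p) q)) (∼.refl ρ)))))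

    into : ∀ {V} → V ∈ concatMap blocksIn (blocks τ) → V ∈ blocks ρ
    into {V} V∈ = go (find (List.∈-concatMap⁻ blocksIn V∈))
      where
      at : ∀ {W} → (∃ λ i → V ≡ blockAt ρ (element (subset W) i)) → V ∈ blocks ρ
      at (i , eq) = subst (_∈ blocks ρ) (sym eq) (blockAt-∈ ρ _)
      go : (∃ λ W → W ∈ blocks τ × V ∈ blocksIn W) → V ∈ blocks ρ
      go (W , W∈ , V∈W) = at {W} (blocksIn⁻ {W = W} W∈ V∈W)

    onto : ∀ {V} → V ∈ blocks ρ → V ∈ concatMap blocksIn (blocks τ)
    onto {V} V∈ = go (∈-blocks⁻ ρ V∈)
      where
      at : ∀ {x} → V ≡ blockAt ρ x → (∃ λ i → element (blockOf τ x) i ≡ x) →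
           V ∈ concatMap blocksIn (blocks τ)
      at {x} V≡ (i , eq) = List.∈-concatMap⁺ blocksIn (lose (blockAt-∈ τ x)
        (subst (_∈ blocksIn W)
          (trans (embed-blockAt (blockAt-∈ τ x) i) (trans (cong (blockAt ρ) eq) (sym V≡)))
          (List.∈-map⁺ (embed W) (blockAt-∈ (restrict ρ W) i))))
        where W = blockAt τ x
      go : (∃ λ x → V ≡ blockAt ρ x) → V ∈ concatMap blocksIn (blocks τ)
      go (x , V≡) = at V≡ (element-onto (blockOf τ x) (∼.refl τ {x}))

  module _ {c ℓ} (M : CommutativeMonoid c ℓ) where
    open CommutativeMonoid M hiding (trans)
    private module ≈ = CommutativeMonoid M
    open BigOperator M

    -- Each block of ρ lies in exactly one block of τ, and `embed` preserves sizes. Taken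
    -- multiplicatively, this says that the weight of ρ is the product of the weights of its
    -- restrictions to the blocks of τ.
    ⨁-blocks : (h : ℕ → Carrier) →
               ⨁ (blocks ρ) (h ∘ size) ≈ ⨁ (blocks τ) (λ W → ⨁ (blocks (restrict ρ W)) (h ∘ size))
    ⨁-blocks h = ≈.trans (⨁-unique (h ∘ size) (Unique-blocks ρ) Unique-concat onto into)
      (≈.trans (⨁-concatMap blocksIn (blocks τ) (h ∘ size))
        (⨁-cong (blocks τ) λ {W} _ → ≈.trans (⨁-map (embed W) (blocks (restrict ρ W)) (h ∘ size))
          (⨁-cong (blocks (restrict ρ W)) λ {V} _ →
            reflexive (cong h (∣embedSubset∣ (subset W) (subset V))))))

-- Independent choice of a partition in each block

module Replace {n} {ρ τ : NC n} (ρ≤τ : ρ ≤ᴺ τ) {W : NonemptySubset n} (W∈ : W ∈ blocks τ)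
               (σ : NC (size W)) where

  private
    S = subset W
    e = element S

    ρ⇒τ : ∀ {i j} → i ∼[ ρ ] j → i ∼[ τ ] j
    ρ⇒τ = ≤ᴺ-elim {π = ρ} {τ} ρ≤τ

    -- Testing the first index of `out` is enough: W is a block of τ and ρ ≤ τ, so the second index
    -- is then outside W too.
    data R : Rel (Fin n) 0ℓ where
      out : ∀ {i j} → ¬ i Subset.∈ S → i ∼[ ρ ] j → R i j
      inn : ∀ {x y} → x ∼[ σ ] y → R (e x) (e y)

    inn⁻ : ∀ {i j x y} → i ≡ e x → j ≡ e y → R i j → x ∼[ σ ] y
    inn⁻ p _ (out i∉S _) = ⊥-elim (i∉S (subst (Subset._∈ S) (sym p) (element-∈ S _)))
    inn⁻ {x = x} {y} p q (inn {x′} {y′} xy)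
      with refl ← element-injective S {x′} {x} p
         | refl ← element-injective S {y′} {y} q = xy

    R? : Decidable R
    R? i j with i ∈? S | j ∈? S
    ... | no i∉S | _ with same? ρ i j
    ...   | yes ij = yes (out i∉S ij)
    ...   | no ¬ij = no λ { (out _ ij) → ¬ij ij ; (inn {x} _) → i∉S (element-∈ S x) }
    R? i j | yes i∈S | no j∉S =
      no λ { (out i∉S _) → i∉S i∈S ; (inn {y = y} _) → j∉S (element-∈ S y) }
    R? i j | yes i∈S | yes j∈S with element-onto S i∈S | element-onto S j∈S
    ... | x , refl | y , refl with same? σ x y
    ...   | yes xy = yes (inn xy)
    ...   | no ¬xy = no (¬xy ∘ inn⁻ refl refl)

    out⁻ : ∀ {i j} → ¬ i Subset.∈ S → R i j → i ∼[ ρ ] j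
    out⁻ i∉S (out _ ij)    = ij
    out⁻ i∉S (inn {x} _)   = ⊥-elim (i∉S (element-∈ S x))

    ∉-closed : ∀ {i j} → ¬ i Subset.∈ S → i ∼[ τ ] j → ¬ j Subset.∈ S
    ∉-closed i∉S ij j∈S = i∉S (block-closed τ W∈ j∈S (∼.sym τ ij))

    R⇒τ : ∀ {i j} → R i j → i ∼[ τ ] j
    R⇒τ (out _ ij)      = ρ⇒τ ij
    R⇒τ (inn {x} {y} _) = block-∼ τ W∈ (element-∈ S x) (element-∈ S y)

    R-refl : ∀ {i} → R i i
    R-refl {i} with i ∈? S
    ... | no i∉S = out i∉S (∼.refl ρ)
    ... | yes i∈S with x , refl ← element-onto S i∈S = inn (∼.refl σ)

    R-sym : ∀ {i j} → R i j → R j i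
    R-sym (out i∉S ij) = out (∉-closed i∉S (ρ⇒τ ij)) (∼.sym ρ ij)
    R-sym (inn xy)     = inn (∼.sym σ xy)

    R-trans : ∀ {i j k} → R i j → R j k → R i k
    R-trans (out i∉S ij) jk = out i∉S (∼.trans ρ ij (out⁻ (∉-closed i∉S (ρ⇒τ ij)) jk))
    R-trans (inn xy) jk = go refl xy jk
      where
      go : ∀ {x y j k} → j ≡ e y → x ∼[ σ ] y → R j k → R (e x) k
      go p xy (out j∉S _) = ⊥-elim (j∉S (subst (Subset._∈ S) (sym p) (element-∈ S _)))
      go {y = y} p xy (inn {y′} yz) with refl ← element-injective S {y′} {y} p = inn (∼.trans σ xy yz)

    R-nonCrossing : NonCrossing _<_ R
    R-nonCrossing ab bc cd (out a∉S ac) (out b∉S bd) = out a∉S (nonCrossing ρ ab bc cd ac bd)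
    -- A crossing between a pair outside W and a pair inside it is also one for τ, which would join
    -- an outside point to the block W.
    R-nonCrossing ab bc cd (out a∉S ac) bd@(inn {x} _) =
      ⊥-elim (∉-closed a∉S (nonCrossing τ ab bc cd (ρ⇒τ ac) (R⇒τ bd)) (element-∈ S x))
    R-nonCrossing ab bc cd ac@(inn {x} _) (out b∉S bd) =
      ⊥-elim (∉-closed b∉S (∼.sym τ (nonCrossing τ ab bc cd (R⇒τ ac) (ρ⇒τ bd))) (element-∈ S x))
    R-nonCrossing ab bc cd (inn xz) (inn yw) = inn (nonCrossing σ
      (element-cancel-< S ab) (element-cancel-< S bc) (element-cancel-< S cd) xz yw)

  opaque
    replace : NC n
    replace = fromRelation R? {{nonZero ρ}}
      (record { refl = R-refl ; sym = R-sym ; trans = R-trans }) R-nonCrossing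

    private
      replace⁺ : ∀ {i j} → R i j → i ∼[ replace ] j
      replace⁺ = relVec⁺ R?

      replace⁻ : ∀ {i j} → i ∼[ replace ] j → R i j
      replace⁻ = relVec⁻ R?

  replace-≤ : replace ≤ᴺ τ
  replace-≤ = ≤ᴺ-intro replace τ (R⇒τ ∘ replace⁻)

  restrict-replace : restrict replace W ≡ σ
  restrict-replace = NC-ext
    (λ {i} {j} p → inn⁻ refl refl (replace⁻ (restrict⁻ replace W {i} {j} p)))
    (λ {i} {j} p → restrict⁺ replace W {i} {j} (replace⁺ (inn p)))

  restrict-replace-≢ : ∀ {V} → V ∈ blocks τ → W ≢ V → restrict replace V ≡ restrict ρ V
  restrict-replace-≢ {V} V∈ W≢V = NC-ext
    (λ {i} {j} p → restrict⁺ ρ V {i} {j} (out⁻ (∉S i) (replace⁻ (restrict⁻ replace V {i} {j} p))))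
    (λ {i} {j} p → restrict⁺ replace V {i} {j} (replace⁺ (out (∉S i) (restrict⁻ ρ V {i} {j} p))))
    where
    ∉S : ∀ i → ¬ element (subset V) i Subset.∈ S
    ∉S i i∈S = W≢V (block-unique τ W∈ V∈ i∈S (element-∈ (subset V) i))

Choice : ∀ {n} → List (NonemptySubset n) → Set
Choice = All (NC ∘ size)

choices : ∀ {n} (Ws : List (NonemptySubset n)) → List (Choice Ws)
choices []       = [ [] ]
choices (W ∷ Ws) = cartesianProductWith _∷_ (allNC (size W)) (choices Ws)

∷-injectiveᴬ : ∀ {a p} {A : Set a} {P : A → Set p} {x xs} {px py : P x} {pxs pys : All P xs} →
               _≡_ {A = All P (x ∷ xs)} (px ∷ pxs) (py ∷ pys) → px ≡ py × pxs ≡ pys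
∷-injectiveᴬ refl = refl , refl

Unique-choices : ∀ {n} (Ws : List (NonemptySubset n)) → Unique (choices Ws)
Unique-choices []       = [] ∷ []
Unique-choices (W ∷ Ws) =
  Unique.cartesianProductWith⁺ _∷_ ∷-injectiveᴬ Unique-allNC (Unique-choices Ws)

∈-choices : ∀ {n} {Ws : List (NonemptySubset n)} (c : Choice Ws) → c ∈ choices Ws
∈-choices []      = here refl
∈-choices (ρ ∷ c) = List.∈-cartesianProductWith⁺ _∷_ (∈-allNC ρ) (∈-choices c)

restrictAll : ∀ {n} (Ws : List (NonemptySubset n)) → NC n → Choice Ws
restrictAll Ws ρ = All.universal (restrict ρ) Ws

module _ {a p} {A : Set a} {P : A → Set p} {f g : ∀ x → P x} where

  universal-cong : ∀ {xs} → (∀ {x} → x ∈ xs → f x ≡ g x) → All.universal f xs ≡ All.universal g xs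
  universal-cong {[]}     f≡g = refl
  universal-cong {x ∷ xs} f≡g = cong₂ _∷_ (f≡g (here refl)) (universal-cong (f≡g ∘ there))

  universal-injective : ∀ {xs} → All.universal f xs ≡ All.universal g xs →
                        ∀ {x} → x ∈ xs → f x ≡ g x
  universal-injective eq (here refl) = proj₁ (∷-injectiveᴬ eq)
  universal-injective eq (there x∈)  = universal-injective (proj₂ (∷-injectiveᴬ eq)) x∈

module _ {n} (τ : NC n) where

  glue : ∀ {Ws} → Unique Ws → (∀ {W} → W ∈ Ws → W ∈ blocks τ) → (c : Choice Ws) →
         Σ[ ρ ∈ NC n ] ρ ≤ᴺ τ × c ≡ restrictAll Ws ρ
  -- Nothing is prescribed yet, so τ itself serves as the starting partition.
  glue []       Ws⊆ []      = τ , ≤ᴺ-refl τ , refl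
  glue {W ∷ Ws} (p ∷ ps) Ws⊆ (σ ∷ c) = extend (glue ps (Ws⊆ ∘ there) c)
    where
    extend : (Σ[ ρ ∈ NC n ] ρ ≤ᴺ τ × c ≡ restrictAll Ws ρ) →
             Σ[ ρ ∈ NC n ] ρ ≤ᴺ τ × σ ∷ c ≡ restrictAll (W ∷ Ws) ρ
    extend (ρ , ρ≤τ , eq) = R.replace , R.replace-≤ ,
      cong₂ _∷_ (sym R.restrict-replace)
        (trans eq (universal-cong λ V∈ →
          sym (R.restrict-replace-≢ (Ws⊆ (there V∈)) (All.lookup p V∈))))
      where module R = Replace {ρ = ρ} {τ} ρ≤τ {W} (Ws⊆ (here refl)) σ

  -- Below τ every related pair lies in a single block of τ and is seen by the restriction to that
  -- block.
  restrictAll-injective : ∀ {ρ ρ′} → ρ ≤ᴺ τ → ρ′ ≤ᴺ τ →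
                          restrictAll (blocks τ) ρ ≡ restrictAll (blocks τ) ρ′ → ρ ≡ ρ′
  restrictAll-injective {ρ} {ρ′} ρ≤τ ρ′≤τ eq = NC-ext (half {ρ} {ρ′} ρ≤τ eq) (half {ρ′} {ρ} ρ′≤τ (sym eq))
    where
    half : ∀ {ρ ρ′} → ρ ≤ᴺ τ → restrictAll (blocks τ) ρ ≡ restrictAll (blocks τ) ρ′ →
           ∀ {i j} → i ∼[ ρ ] j → i ∼[ ρ′ ] j
    half {ρ} {ρ′} ρ≤τ eq {i} {j} ij =
      go (element-onto (blockOf τ i) (∼.refl τ)) (element-onto (blockOf τ i) (≤ᴺ-elim {π = ρ} {τ} ρ≤τ ij))
      where
      W = blockAt τ i
      go : (∃ λ x → element (subset W) x ≡ i) → (∃ λ y → element (subset W) y ≡ j) → i ∼[ ρ′ ] j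
      go (x , p) (y , q) = subst₂ (SameBlock (blockVec ρ′)) p q
        (restrict⁻ ρ′ W {x} {y} (subst (x ∼[_] y) (universal-injective eq (blockAt-∈ τ i))
          (restrict⁺ ρ W {x} {y} (subst₂ (SameBlock (blockVec ρ)) (sym p) (sym q) ij))))

-- Convolution sums over intervals

interval↓ interval↑ : ∀ {n} → NC n → List (NC n)
interval↓ τ = filter (_≤ᴺ? τ) (allNC _)
interval↑ π = filter (π ≤ᴺ?_) (allNC _)

module _ {n} (π : NC n) where

  ∈-interval↓⁺ : ∀ {ρ} → ρ ≤ᴺ π → ρ ∈ interval↓ π
  ∈-interval↓⁺ {ρ} = List.∈-filter⁺ (_≤ᴺ? π) (∈-allNC ρ)

  ∈-interval↓⁻ : ∀ {ρ} → ρ ∈ interval↓ π → ρ ≤ᴺ π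
  ∈-interval↓⁻ ρ∈ = proj₂ (List.∈-filter⁻ (_≤ᴺ? π) {xs = allNC n} ρ∈)

  ∈-interval↑⁺ : ∀ {σ} → π ≤ᴺ σ → σ ∈ interval↑ π
  ∈-interval↑⁺ {σ} = List.∈-filter⁺ (π ≤ᴺ?_) (∈-allNC σ)

  ∈-interval↑⁻ : ∀ {σ} → σ ∈ interval↑ π → π ≤ᴺ σ
  ∈-interval↑⁻ σ∈ = proj₂ (List.∈-filter⁻ (π ≤ᴺ?_) {xs = allNC n} σ∈)

module Sums {c ℓ} (K : CommutativeRing c ℓ) where

  open CommutativeRing K hiding (refl; sym; trans)
  private module ≈ = CommutativeRing K
  module + = BigOperator +-commutativeMonoid
  module * = BigOperator *-commutativeMonoid
  open + using () renaming (⨁ to ∑) public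
  open * using () renaming (⨁ to ∏) public

  ∑-distribˡ : ∀ {a} {A : Set a} k (xs : List A) f → k * ∑ xs f ≈ ∑ xs (λ x → k * f x)
  ∑-distribˡ k []       f = zeroʳ k
  ∑-distribˡ k (x ∷ xs) f = ≈.trans (distribˡ k _ _) (+-congˡ (∑-distribˡ k xs f))

  ∑-distribʳ : ∀ {a} {A : Set a} k (xs : List A) f → ∑ xs f * k ≈ ∑ xs (λ x → f x * k)
  ∑-distribʳ k []       f = zeroˡ k
  ∑-distribʳ k (x ∷ xs) f = ≈.trans (distribʳ k _ _) (+-congˡ (∑-distribʳ k xs f))

  ∑-cartesianProduct : ∀ {a b d} {A : Set a} {B : Set b} {D : Set d} (h : A → B → D) xs ys f →
    ∑ (cartesianProductWith h xs ys) f ≈ ∑ xs (λ x → ∑ ys (λ y → f (h x y)))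
  ∑-cartesianProduct h []       ys f = ≈.refl
  ∑-cartesianProduct h (x ∷ xs) ys f = ≈.trans (+.⨁-++ (map (h x) ys) _ f)
    (+-cong (+.⨁-map (h x) ys f) (∑-cartesianProduct h xs ys f))

  module _ (G : ∀ {m} → NC m → Carrier) where

    weight : ∀ {n} {Ws : List (NonemptySubset n)} → Choice Ws → Carrier
    weight []      = 1#
    weight (ρ ∷ c) = G ρ * weight c

    ∏∑-choices : ∀ {n} (Ws : List (NonemptySubset n)) →
                 ∏ Ws (λ W → ∑ (allNC (size W)) G) ≈ ∑ (choices Ws) weight
    ∏∑-choices []       = ≈.sym (+-identityʳ 1#)
    ∏∑-choices (W ∷ Ws) = ≈.trans (*-congˡ (∏∑-choices Ws))
      (≈.trans (∑-distribʳ _ (allNC (size W)) G)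
        (≈.trans (+.⨁-cong (allNC (size W)) λ {ρ} _ → ∑-distribˡ (G ρ) (choices Ws) weight)
          (≈.sym (∑-cartesianProduct _∷_ (allNC (size W)) (choices Ws) weight))))

    weight-restrictAll : ∀ {n} (Ws : List (NonemptySubset n)) ρ →
                         weight (restrictAll Ws ρ) ≡ ∏ Ws (λ W → G (restrict ρ W))
    weight-restrictAll []       ρ = refl
    weight-restrictAll (W ∷ Ws) ρ = cong (G (restrict ρ W) *_) (weight-restrictAll Ws ρ)

    -- The distributive law produces a sum over choices of one partition per block; `restrictAll`
    -- identifies the interval below τ with these choices, and `glue` supplies the surjectivity.
    ∏∑-blocks : ∀ {n} (τ : NC n) →
                ∏ (blocks τ) (λ W → ∑ (allNC (size W)) G) ≈
                ∑ (interval↓ τ) (λ ρ → ∏ (blocks τ) (λ W → G (restrict ρ W)))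
    ∏∑-blocks τ = ≈.trans (∏∑-choices (blocks τ))
      (≈.trans (+.⨁-reindex (restrictAll (blocks τ)) weight
                 (Unique.filter⁺ (_≤ᴺ? τ) Unique-allNC) (Unique-choices (blocks τ))
                 (λ _ → ∈-choices _)
                 (λ ρ∈ ρ′∈ → restrictAll-injective τ (∈-interval↓⁻ τ ρ∈) (∈-interval↓⁻ τ ρ′∈))
                 (λ {c} _ → let ρ , ρ≤τ , eq = glue τ (Unique-blocks τ) (λ W∈ → W∈) c in
                            ρ , ∈-interval↓⁺ τ ρ≤τ , eq))
               (+.⨁-cong (interval↓ τ) λ {ρ} _ → reflexive (weight-restrictAll (blocks τ) ρ)))

  ∑-interval : ∀ {n} (π : NC n) (F : NC n → Carrier) →
               ∑ (interval↓ (Kr π)) F ≈ ∑ (interval↑ π) (λ σ → F (σ ⊓ Kr π))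
  ∑-interval π F = +.⨁-reindex (_⊓ Kr π) F
    (Unique.filter⁺ (π ≤ᴺ?_) Unique-allNC) (Unique.filter⁺ (_≤ᴺ? Kr π) Unique-allNC)
    (λ {σ} _ → ∈-interval↓⁺ (Kr π) (⊓-≤ʳ σ (Kr π)))
    (λ σ∈ σ′∈ → ⊓-Kr-injective π (∈-interval↑⁻ π σ∈) (∈-interval↑⁻ π σ′∈))
    (λ {ρ} ρ∈ → let σ , π≤σ , eq = ⊓-Kr-surjective π (∈-interval↓⁻ (Kr π) ρ∈) in
                σ , ∈-interval↑⁺ π π≤σ , eq)

  module _ (a b : ℕ → Carrier) where

    private
      α β : ∀ {n} → NC n → Carrier
      α π = ∏ (blocks π) (λ V → a (size V))
      β π = ∏ (blocks π) (λ V → b (size V))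

    -- Here a m and b m stand for the values of χ₁ and χ₂ at `Y m`. The left side is then χ₁ * χ₂
    -- evaluated at `Yᴺ (Kr π)`, the right side Ψ*χ₁ * Ψ*χ₂ evaluated at `X π`.
    convolution-Kr : ∀ {n} (π : NC n) →
      ∏ (blocks (Kr π)) (λ W → ∑ (allNC (size W)) (λ ρ → α ρ * β (Kr ρ))) ≈
      ∑ (interval↑ π) (λ σ → ∏ (blocks σ) (λ W → α (Kr (restrict π W))) * β (Kr σ))
    convolution-Kr {n} π = begin
      ∏ (blocks τ) (λ W → ∑ (allNC (size W)) (λ ρ → α ρ * β (Kr ρ)))
        ≈⟨ ∏∑-blocks (λ ρ → α ρ * β (Kr ρ)) τ ⟩
      ∑ (interval↓ τ) (λ ρ → ∏ (blocks τ) (λ W → α (restrict ρ W) * β (Kr (restrict ρ W))))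
        ≈⟨ +.⨁-cong (interval↓ τ) (λ {ρ} ρ∈ → split ρ (∈-interval↓⁻ τ ρ∈)) ⟩
      ∑ (interval↓ τ) (λ ρ → α ρ * β (τ ⊓ Kr ρ))
        ≈⟨ ∑-interval π (λ ρ → α ρ * β (τ ⊓ Kr ρ)) ⟩
      ∑ (interval↑ π) (λ σ → α (σ ⊓ τ) * β (τ ⊓ Kr (σ ⊓ τ)))
        ≈⟨ +.⨁-cong (interval↑ π) (λ {σ} σ∈ → merge σ (∈-interval↑⁻ π σ∈)) ⟩
      ∑ (interval↑ π) (λ σ → ∏ (blocks σ) (λ W → α (Kr (restrict π W))) * β (Kr σ)) ∎
      where
      open import Relation.Binary.Reasoning.Setoid setoid
      τ = Kr π

      split : ∀ ρ → ρ ≤ᴺ τ →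
              ∏ (blocks τ) (λ W → α (restrict ρ W) * β (Kr (restrict ρ W))) ≈ α ρ * β (τ ⊓ Kr ρ)
      split ρ ρ≤τ = ≈.trans
        (*.⨁-∙ (blocks τ) (λ W → α (restrict ρ W)) (λ W → β (Kr (restrict ρ W))))
        (*-cong (≈.sym (⨁-blocks {ρ = ρ} {τ} ρ≤τ *-commutativeMonoid a))
          (≈.trans (*.⨁-cong (blocks τ) λ W∈ → reflexive (cong β (Kr-restrict {ρ = ρ} {τ} ρ≤τ W∈)))
                   (≈.sym (⨁-blocks {ρ = τ ⊓ Kr ρ} {τ} (⊓-≤ˡ τ (Kr ρ)) *-commutativeMonoid b))))

      merge : ∀ σ → π ≤ᴺ σ → α (σ ⊓ τ) * β (τ ⊓ Kr (σ ⊓ τ)) ≈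
                             ∏ (blocks σ) (λ W → α (Kr (restrict π W))) * β (Kr σ)
      -- `Kr-restrict` is now used for π ≤ σ, whereas `split` uses it for ρ ≤ τ: as τ is Kr π, the
      -- complement of π relative to σ is σ ⊓ τ.
      merge σ π≤σ = *-cong
        (≈.trans (⨁-blocks {ρ = σ ⊓ τ} {σ} (⊓-≤ˡ σ τ) *-commutativeMonoid a)
          (*.⨁-cong (blocks σ) λ W∈ → reflexive (cong α (sym (Kr-restrict {ρ = π} {σ} π≤σ W∈)))))
        (reflexive (cong β (sym (Kr-≥ π σ π≤σ))))

-- Characters

size-𝟙 : ∀ {n} .{{_ : NonZero n}} i → size (blockAt (𝟙 n) i) ≡ n
size-𝟙 {n} i = trans (cong ∣_∣ (⊆-antisym (⊆-max (blockOf (𝟙 n) i)) (λ {j} _ → 𝟙-∼ {n} {i} {j}))) (∣⊤∣≡n n)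

restrict-𝟘 : ∀ {n} .{{_ : NonZero n}} (W : NonemptySubset n) .{{_ : NonZero (size W)}} →
             restrict (𝟘 n) W ≡ 𝟘 (size W)
restrict-𝟘 {n} W = NC-ext
  (λ {i} {j} p → relVec⁺ Fin._≟_ {i} {j}
    (element-injective (subset W) (relVec⁻ Fin._≟_ {element (subset W) i} (restrict⁻ (𝟘 n) W {i} {j} p))))
  (λ {i} {j} p → restrict⁺ (𝟘 n) W {i} {j}
    (relVec⁺ Fin._≟_ {element (subset W) i} (cong (element (subset W)) (relVec⁻ Fin._≟_ {i} {j} p))))

Fin-<2 : ∀ {m} → ¬ 2 ℕ.≤ m → (x y : Fin m) → x ≡ y
Fin-<2 {suc zero}    _   zero zero = refl
Fin-<2 {suc (suc m)} m≱2 _    _    = ⊥-elim (m≱2 (ℕ.s≤s (ℕ.s≤s ℕ.z≤n)))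

-- Meant for the counit: if π is not the one-block partition, Kr π has a block of size at least 2,
-- so the image of `X π` under Ψ has a factor that the counit kills.
large-block : ∀ {n} (τ : NC n) .{{_ : NonZero n}} → τ ≢ 𝟘 n → ∃ λ W → W ∈ blocks τ × 2 ℕ.≤ size W
large-block {n} τ τ≢𝟘 with any? (λ W → 2 ℕ.≤? size W) (blocks τ)
... | yes p   = find p
... | no none = ⊥-elim (τ≢𝟘 (sym (≤ᴺ-antisym (𝟘-≤ᴺ τ) (≤ᴺ-intro τ (𝟘 n) λ p → relVec⁺ Fin._≟_ (equal p)))))
  where
  equal : ∀ {i j} → i ∼[ τ ] j → i ≡ j
  equal {i} {j} ij = go (element-onto (blockOf τ i) (∼.refl τ)) (element-onto (blockOf τ i) ij)
    where
    go : (∃ λ x → element (blockOf τ i) x ≡ i) → (∃ λ y → element (blockOf τ i) y ≡ j) → i ≡ j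
    go (x , p) (y , q) = trans (sym p)
      (trans (cong (element (blockOf τ i)) (Fin-<2 (none ∘ lose (blockAt-∈ τ i)) x y)) q)

module _ {c ℓ} (M : CommutativeMonoid c ℓ) where

  open CommutativeMonoid M using (Carrier; _≈_; ε; _∙_; identityʳ; reflexive; ∙-cong; identityˡ)
  private module ≈ = CommutativeMonoid M
  open BigOperator M

  ⨁-blocks-𝟙 : ∀ {n} .{{_ : NonZero n}} → Fin n → (h : ℕ → Carrier) → ⨁ (blocks (𝟙 n)) (h ∘ size) ≈ h n
  ⨁-blocks-𝟙 {n} i h = ≈.trans
    (⨁-unique {ys = [ W ]} (h ∘ size) (Unique-blocks (𝟙 n)) ([] ∷ []) only
      (λ { (here refl) → blockAt-∈ (𝟙 n) i }))
    (≈.trans (identityʳ _) (reflexive (cong h (size-𝟙 i))))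
    where
    W = blockAt (𝟙 n) i
    only : ∀ {V} → V ∈ blocks (𝟙 n) → V ∈ [ W ]
    only {V} V∈ = go (∈-blocks⁻ (𝟙 n) V∈)
      where
      go : (∃ λ j → V ≡ blockAt (𝟙 n) j) → V ∈ [ W ]
      go (j , eq) = here (trans eq (block-unique (𝟙 n) (blockAt-∈ (𝟙 n) j) (blockAt-∈ (𝟙 n) i)
        {j} (𝟙-∼ {n} {j} {j}) (𝟙-∼ {n} {i} {j})))

  ⨁-blocks-𝟘 : ∀ {n} .{{_ : NonZero n}} (h : ℕ → Carrier) → h 1 ≈ ε → ⨁ (blocks (𝟘 n)) (h ∘ size) ≈ ε
  ⨁-blocks-𝟘 {n} h h1 = go (blocks-𝟘 n)
    where
    go : ∀ {Ws : List (NonemptySubset n)} → All (λ W → size W ≡ 1) Ws → ⨁ Ws (h ∘ size) ≈ ε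
    go []       = ≈.refl
    go (p ∷ ps) = ≈.trans (∙-cong (≈.trans (reflexive (cong h p)) h1) (go ps)) (identityˡ ε)

module Characters {c ℓ} (K : CommutativeRing c ℓ) where

  open Over K
  open CommutativeAlgebra using (Carrier)
  open AlgHom using (⟦_⟧)
  open Sums K
  private module K = CommutativeRing K

  module _ {a ℓᵃ b ℓᵇ} {A : CommutativeAlgebra a ℓᵃ} {B : CommutativeAlgebra b ℓᵇ} (φ : AlgHom A B) where

    private
      module A = CommutativeAlgebra A
      module B = CommutativeAlgebra B
      module φ = AlgHom φ

    homo-∏ : ∀ {x} {X : Set x} (xs : List X) f → φ.⟦ A.∏ xs f ⟧ B.≈ B.∏ xs (λ x → φ.⟦ f x ⟧)
    homo-∏ []       f = φ.1#-homo
    homo-∏ (x ∷ xs) f = B.trans (φ.*-homo _ _) (B.*-congˡ (homo-∏ xs f))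

    homo-∑ : ∀ {x} {X : Set x} (xs : List X) f → φ.⟦ A.∑ xs f ⟧ B.≈ B.∑ xs (λ x → φ.⟦ f x ⟧)
    homo-∑ []       f = φ.0#-homo
    homo-∑ (x ∷ xs) f = B.trans (φ.+-homo _ _) (B.+-congˡ (homo-∑ xs f))

  module _ {i} {I : Set i} {b ℓᵇ} {B : CommutativeAlgebra b ℓᵇ} (φ ψ : AlgHom (Polynomial I) B) where

    private
      module B = CommutativeAlgebra B
      module φ = AlgHom φ
      module ψ = AlgHom ψ

    polyHom-unique : (∀ i → φ.⟦ gen i ⟧ B.≈ ψ.⟦ gen i ⟧) → ∀ x → φ.⟦ x ⟧ B.≈ ψ.⟦ x ⟧
    polyHom-unique eq (gen i)  = eq i
    polyHom-unique eq (con k)  = B.trans (φ.fromK-homo k) (B.sym (ψ.fromK-homo k))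
    polyHom-unique eq (x :+ y) = B.trans (φ.+-homo x y)
      (B.trans (B.+-cong (polyHom-unique eq x) (polyHom-unique eq y)) (B.sym (ψ.+-homo x y)))
    polyHom-unique eq (x :* y) = B.trans (φ.*-homo x y)
      (B.trans (B.*-cong (polyHom-unique eq x) (polyHom-unique eq y)) (B.sym (ψ.*-homo x y)))
    polyHom-unique eq (:- x)   = B.trans (φ.-‿homo x)
      (B.trans (B.-‿cong (polyHom-unique eq x)) (B.sym (ψ.-‿homo x)))

  private
    module 𝕏Sym = RawMonoid (𝕏 Sym)
    module 𝕏𝒯 = RawMonoid (𝕏 𝒯)

  Y-≥2 : ∀ {n} .(n≥2 : 2 ℕ.≤ n) → Y n ≡ gen (index n n≥2)
  Y-≥2 {n} n≥2 with 2 ℕ.≤? n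
  ... | yes _  = refl
  ... | no n≱2 = contradiction-irr n≥2 n≱2

  size≢0 : ∀ {n} (W : NonemptySubset n) → NonZero (size W)
  size≢0 (mkNonempty W ne) = recompute (ℕ.nonZero? ∣ W ∣) (size-nonZero W ne)

  module _ (χ : Character Sym) where

    Ψ*-X : ∀ {n} (π : NC n) → ⟦ Ψ* χ ⟧ (X π) K.≈ ∏ (blocks (Kr π)) (λ W → ⟦ χ ⟧ (Y (size W)))
    Ψ*-X π = K.trans (AlgHom.⟦⟧-cong χ (Ψ-X π)) (homo-∏ χ (blocks (Kr π)) (λ W → Y (size W)))

    Ψ*-X-𝟘 : ∀ {n} .{{_ : NonZero n}} → Fin n → ⟦ Ψ* χ ⟧ (X (𝟘 n)) K.≈ ⟦ χ ⟧ (Y n)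
    Ψ*-X-𝟘 {n} i = K.trans (Ψ*-X (𝟘 n))
      (K.trans (K.reflexive (cong (λ τ → ∏ (blocks τ) (λ W → ⟦ χ ⟧ (Y (size W)))) (Kr-𝟘 {n})))
               (⨁-blocks-𝟙 K.*-commutativeMonoid i (λ m → ⟦ χ ⟧ (Y m))))

  Ψ*-cong : ∀ {χ₁ χ₂} → χ₁ 𝕏Sym.≈ χ₂ → Ψ* χ₁ 𝕏𝒯.≈ Ψ* χ₂
  Ψ*-cong χ₁≈χ₂ x = χ₁≈χ₂ (⟦ Ψ ⟧ x)

  Ψ*-injective : ∀ {χ₁ χ₂} → Ψ* χ₁ 𝕏𝒯.≈ Ψ* χ₂ → χ₁ 𝕏Sym.≈ χ₂
  Ψ*-injective {χ₁} {χ₂} eq = polyHom-unique χ₁ χ₂ λ (index n n≥2) → onY n n≥2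
    where
    onY : ∀ n .(n≥2 : 2 ℕ.≤ n) → ⟦ χ₁ ⟧ (gen (index n n≥2)) K.≈ ⟦ χ₂ ⟧ (gen (index n n≥2))
    onY n n≥2 = K.trans (K.reflexive (cong ⟦ χ₁ ⟧ (sym (Y-≥2 n≥2))))
      (K.trans (K.sym (Ψ*-X-𝟘 χ₁ i)) (K.trans (eq (X (𝟘 n)))
        (K.trans (Ψ*-X-𝟘 χ₂ i) (K.reflexive (cong ⟦ χ₂ ⟧ (Y-≥2 n≥2))))))
      where
      instance
        n≢0 : NonZero n
        n≢0 = ℕ.>-nonZero (ℕ.≤-trans (ℕ.s≤s ℕ.z≤n) (recompute (2 ℕ.≤? n) n≥2))
      i : Fin n
      i = fromℕ< (ℕ.≤-trans (ℕ.s≤s ℕ.z≤n) n≥2)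

  ∏-zero : ∀ {x} {X : Set x} {xs : List X} f {x} → x ∈ xs → f x K.≈ K.0# → ∏ xs f K.≈ K.0#
  ∏-zero f (here refl) eq = K.trans (K.*-congʳ eq) (K.zeroˡ _)
  ∏-zero f (there x∈)  eq = K.trans (K.*-congˡ (∏-zero f x∈ eq)) (K.zeroʳ _)

  Ψ*-ε : Ψ* 𝕏Sym.ε 𝕏𝒯.≈ 𝕏𝒯.ε
  Ψ*-ε = polyHom-unique (Ψ* 𝕏Sym.ε) 𝕏𝒯.ε λ (index π π≢𝟙) → onX π π≢𝟙
    where
    onX : ∀ {n} (π : NC n) .(π≢𝟙 : π ≢ 𝟙 n {{nonZero π}}) →
          ⟦ 𝕏Sym.ε ⟧ (Yᴺ (Kr π)) K.≈ K.0#
    onX {n} π π≢𝟙 = go (large-block (Kr π) {{nonZero π}}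
        λ eq → contradiction-irr π≢𝟙 λ ≢𝟙 → ≢𝟙 (Kr-injective (trans eq (sym (Kr-𝟙 {n} {{nonZero π}})))))
      where
      go : (∃ λ W → W ∈ blocks (Kr π) × 2 ℕ.≤ size W) → ⟦ 𝕏Sym.ε ⟧ (Yᴺ (Kr π)) K.≈ K.0#
      go (W , W∈ , ≥2) = K.trans (homo-∏ 𝕏Sym.ε (blocks (Kr π)) (λ W → Y (size W)))
        (∏-zero (λ W → ⟦ 𝕏Sym.ε ⟧ (Y (size W))) W∈ (K.reflexive (cong ⟦ 𝕏Sym.ε ⟧ (Y-≥2 ≥2))))

  module _ (χ₁ χ₂ : Character Sym) where

    private
      α β : ∀ {n} → NC n → K.Carrier
      α π = ∏ (blocks π) (λ V → ⟦ χ₁ ⟧ (Y (size V)))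
      β π = ∏ (blocks π) (λ V → ⟦ χ₂ ⟧ (Y (size V)))

    ∙-Y : ∀ n .{{_ : NonZero n}} →
          ⟦ χ₁ 𝕏Sym.∙ χ₂ ⟧ (Y n) K.≈ ∑ (allNC n) (λ ρ → α ρ K.* β (Kr ρ))
    -- Kr π may have singleton blocks, so the coproduct formula is also needed at the unit `Y 1`.
    -- The only partition of one point is its own complement, and its weight is the value of a
    -- character at 1.
    ∙-Y (suc zero) = K.sym (K.trans (K.+-identityʳ _)
      (K.trans (K.*-cong (one χ₁) (K.trans (K.reflexive (cong β (Kr-𝟙 {1}))) (one χ₂))) (K.*-identityˡ _)))
      where
      one : ∀ (χ : Character Sym) → ∏ (blocks (𝟘 1)) (λ V → ⟦ χ ⟧ (Y (size V))) K.≈ K.1#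
      one χ = ⨁-blocks-𝟘 K.*-commutativeMonoid {1} (λ m → ⟦ χ ⟧ (Y m)) (AlgHom.1#-homo χ)
    ∙-Y n@(suc (suc _)) = K.trans (homo-∑ (χ₁ ⊗ᵡ χ₂) (allNC n) _)
      (+.⨁-cong (allNC n) λ {ρ} _ → K.*-cong (homo-∏ χ₁ (blocks ρ) _) (homo-∏ χ₂ (blocks (Kr ρ)) _))

    Ψ*-∙ : Ψ* (χ₁ 𝕏Sym.∙ χ₂) 𝕏𝒯.≈ Ψ* χ₁ 𝕏𝒯.∙ Ψ* χ₂
    Ψ*-∙ = polyHom-unique (Ψ* (χ₁ 𝕏Sym.∙ χ₂)) (Ψ* χ₁ 𝕏𝒯.∙ Ψ* χ₂) λ (index π _) → onX π
      where
      open import Relation.Binary.Reasoning.Setoid K.setoid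
      onX : ∀ {n} (π : NC n) → ⟦ χ₁ 𝕏Sym.∙ χ₂ ⟧ (Yᴺ (Kr π)) K.≈
        ⟦ Ψ* χ₁ ⊗ᵡ Ψ* χ₂ ⟧ (CommutativeAlgebra.∑ (𝒯ᵃ ⊗ᵃ 𝒯ᵃ) (interval↑ π) λ σ →
          gen (CommutativeAlgebra.∏ 𝒯ᵃ (blocks σ) (λ W → X (restrict π W)) , X σ))
      onX π = begin
        ⟦ χ₁ 𝕏Sym.∙ χ₂ ⟧ (Yᴺ (Kr π))
          ≈⟨ homo-∏ (χ₁ 𝕏Sym.∙ χ₂) (blocks (Kr π)) (λ W → Y (size W)) ⟩
        ∏ (blocks (Kr π)) (λ W → ⟦ χ₁ 𝕏Sym.∙ χ₂ ⟧ (Y (size W)))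
          ≈⟨ *.⨁-cong (blocks (Kr π)) (λ {W} _ → ∙-Y (size W) {{size≢0 W}}) ⟩
        ∏ (blocks (Kr π)) (λ W → ∑ (allNC (size W)) (λ ρ → α ρ K.* β (Kr ρ)))
          ≈⟨ convolution-Kr (λ m → ⟦ χ₁ ⟧ (Y m)) (λ m → ⟦ χ₂ ⟧ (Y m)) π ⟩
        ∑ (interval↑ π) (λ σ → ∏ (blocks σ) (λ W → α (Kr (restrict π W))) K.* β (Kr σ))
          ≈⟨ +.⨁-cong (interval↑ π) (λ {σ} _ → K.*-cong
               (K.trans (homo-∏ (Ψ* χ₁) (blocks σ) (λ W → X (restrict π W)))
                        (*.⨁-cong (blocks σ) λ {W} _ → Ψ*-X χ₁ (restrict π W)))
               (Ψ*-X χ₂ σ)) ⟨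
        ∑ (interval↑ π) (λ σ → ⟦ Ψ* χ₁ ⟧ (CommutativeAlgebra.∏ 𝒯ᵃ (blocks σ) (λ W → X (restrict π W)))
                               K.* ⟦ Ψ* χ₂ ⟧ (X σ))
          ≈⟨ homo-∑ (Ψ* χ₁ ⊗ᵡ Ψ* χ₂) (interval↑ π) _ ⟨
        ⟦ Ψ* χ₁ ⊗ᵡ Ψ* χ₂ ⟧ (CommutativeAlgebra.∑ (𝒯ᵃ ⊗ᵃ 𝒯ᵃ) (interval↑ π) λ σ →
          gen (CommutativeAlgebra.∏ 𝒯ᵃ (blocks σ) (λ W → X (restrict π W)) , X σ)) ∎

  -- Multiplicativity turns the value of f at (π, 1) into that at (0, Kr π), which factorises over
  -- the blocks W of Kr π. Restricting 0 to W gives 0 again, so each factor is the value of `χ̂ f`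
  -- at `Y (size W)`.
  Ψ*-χ̂ : ∀ (f : 𝒢) → Ψ* (χ̂ f) 𝕏𝒯.≈ χ (𝒢.g~ f)
  Ψ*-χ̂ f = polyHom-unique (Ψ* (χ̂ f)) (χ (𝒢.g~ f)) λ (index π _) → onX π
    where
    onX : ∀ {n} (π : NC n) → ⟦ χ̂ f ⟧ (Yᴺ (Kr π)) K.≈ 𝒢.fun f [ π ,𝟙]
    onX {n} π = K.trans (homo-∏ (χ̂ f) (blocks (Kr π)) (λ W → Y (size W)))
      (K.trans (*.⨁-cong (blocks (Kr π)) λ {W} _ → factor W (size≢0 W))
        (K.sym (K.trans (𝒢.multiplicative f π)
          (𝒢.factorisation f (𝟘 n {{nonZero π}}) (Kr π) (𝟘-≤ᴺ {{nonZero π}} (Kr π))))))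
      where
      factor : ∀ W → NonZero (size W) →
               ⟦ χ̂ f ⟧ (Y (size W)) K.≈ 𝒢.fun f [ restrict (𝟘 n {{nonZero π}}) W ,𝟙]
      factor W nz = K.trans (χ̂-Y f (size W) {{nz}})
        (K.reflexive (cong (λ ρ → 𝒢.fun f [ ρ ,𝟙]) (sym (restrict-𝟘 {n} {{nonZero π}} W {{nz}}))))

  Ψ*-isMonoidMonomorphism : MonoidMorphisms.IsMonoidMonomorphism (𝕏 Sym) (𝕏 𝒯) Ψ*
  Ψ*-isMonoidMonomorphism = record
    { isMonoidHomomorphism = record
      { isMagmaHomomorphism = record
        { isRelHomomorphism = record { cong = λ {χ₁} {χ₂} → Ψ*-cong {χ₁} {χ₂} }
        ; homo = Ψ*-∙ }
      ; ε-homo = Ψ*-ε }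
    ; injective = λ {χ₁} {χ₂} → Ψ*-injective {χ₁} {χ₂} }

  Ψ*-inverse : ∀ χ₁ χ₂ → IsInverse (𝕏 Sym) χ₁ χ₂ → IsInverse (𝕏 𝒯) (Ψ* χ₁) (Ψ* χ₂)
  Ψ*-inverse χ₁ χ₂ (p , q) = half χ₁ χ₂ p , half χ₂ χ₁ q
    where
    half : ∀ χ₁ χ₂ → (χ₁ 𝕏Sym.∙ χ₂) 𝕏Sym.≈ 𝕏Sym.ε → (Ψ* χ₁ 𝕏𝒯.∙ Ψ* χ₂) 𝕏𝒯.≈ 𝕏𝒯.ε
    half χ₁ χ₂ p x = K.trans (K.sym (Ψ*-∙ χ₁ χ₂ x)) (K.trans (p (⟦ Ψ ⟧ x)) (Ψ*-ε x))

corollary14p7 :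
  ∀ {c ℓ} (K : CommutativeRing c ℓ) → let open Over K in
    ( MonoidMorphisms.IsMonoidMonomorphism (𝕏 Sym) (𝕏 𝒯) Ψ*
    × (∀ (χ₁ χ₂ : Character Sym) →
         IsInverse (𝕏 Sym) χ₁ χ₂ → IsInverse (𝕏 𝒯) (Ψ* χ₁) (Ψ* χ₂)) )
  × (∀ (f : 𝒢) → RawMonoid._≈_ (𝕏 𝒯) (Ψ* (χ̂ f)) (χ (𝒢.g~ f)))
corollary14p7 K = (Ψ*-isMonoidMonomorphism , Ψ*-inverse) , Ψ*-χ̂
  where open Characters K
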